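{- Let $f\colon\{ -1,1\}^{n^2}\to\{ -1,1\}$ be given by $f(x)=\mathrm{sign}\left(1+\sum_{i=1}^n\sum_{j=1}^n 2^ix_{ij}\right)$ and let $g\colon\{ -1,1\}^{\lceil\sqrt n\rceil}\to\{ -1,1\}$ be the majority function. Then $\deg_{\pm}(f\wedge g)=\Theta(\sqrt n)$.
   Context: Boolean values: $-1$ is true, $+1$ is false. Majority on $m$ bits: $\mathrm{MAJ}_m(x)=1$ if $\sum x_i>0$, $-1$ otherwise. $f\wedge g$ is $(x,y)\mapsto f(x)\wedge g(y)$ on the product of the domains. The threshold degree $\deg_{\pm}(h)$ is the least total degree of a real polynomial $p$ with $h(z)p(z)>0$ on the domain of $h$.
   Formalization: The polynomials in the definition of threshold degree have rational rather than real coefficients; since the domain is finite and the sign conditions are strict, a small perturbation of the coefficients shows the threshold degree is the same. -}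

module Defs where

open import Data.Nat as ℕ using (ℕ; zero; suc; _≤?_)
open import Data.Integer as ℤ using (ℤ)
open import Data.Rational as ℚ using (ℚ; 0ℚ; 1ℚ)
open import Data.Fin using (Fin; toℕ)
open import Data.List using (List; []; _∷_; foldr; map; allFin; length)
open import Data.Product using (_×_; _,_; proj₁; proj₂)
open import Data.Sum using (_⊎_; inj₁; inj₂)
open import Data.Sign using (Sign) renaming (- to s-; + to s+)
open import Relation.Nullary using (yes; no)

-- Boolean values are signs: Sign.- (= -1) is TRUE, Sign.+ (= +1) is FALSE.
-- A point of the cube {-1,1}^V is a function V → Sign.

signℤ : Sign → ℤ
signℤ s- = ℤ.-[1+ 0 ]
signℤ s+ = ℤ.+ 1

signℚ : Sign → ℚ
signℚ s- = ℚ.- 1ℚ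
signℚ s+ = 1ℚ

sumℤ : List ℤ → ℤ
sumℤ = foldr ℤ._+_ (ℤ.+ 0)

sgn : ℤ → Sign
sgn (ℤ.+ zero)  = s-
sgn (ℤ.+ suc _) = s+
sgn ℤ.-[1+ _ ]  = s-

-- f(x) = sign(1 + Σ_{i,j=1}^n 2^i x_ij), variables indexed by Fin n × Fin n
-- (index i : Fin n stands for i+1 ∈ {1..n})
fFun : (n : ℕ) → (Fin n × Fin n → Sign) → Sign
fFun n x = sgn (ℤ.+ 1 ℤ.+ sumℤ (map (λ i → sumℤ (map (λ j →
             ℤ.+ (2 ℕ.^ suc (toℕ i)) ℤ.* signℤ (x (i , j))) (allFin n))) (allFin n)))

MAJ : (m : ℕ) → (Fin m → Sign) → Sign
MAJ m x = sgn (sumℤ (map (λ i → signℤ (x i)) (allFin m)))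

csqrtAux : ℕ → ℕ → ℕ → ℕ
csqrtAux n zero k = k
csqrtAux n (suc fuel) k with n ≤? k ℕ.* k
... | yes _ = k
... | no  _ = csqrtAux n fuel (suc k)

ceilSqrt : ℕ → ℕ
ceilSqrt n = csqrtAux n (suc n) 0

_∧ₛ_ : Sign → Sign → Sign
s- ∧ₛ s- = s-
_  ∧ₛ _  = s+

_∧F_ : {V W : Set} → ((V → Sign) → Sign) → ((W → Sign) → Sign) → ((V ⊎ W → Sign) → Sign)
(f ∧F g) z = f (λ v → z (inj₁ v)) ∧ₛ g (λ w → z (inj₂ w))

-- Polynomials in variables from V with rational coefficients: a finite list of terms
-- (coefficient, monomial), a monomial being a list of variables (with repetition).
Poly : Set → Set
Poly V = List (ℚ × List V)

evalMono : {V : Set} → (V → Sign) → List V → ℚ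
evalMono z = foldr (λ v r → signℚ (z v) ℚ.* r) 1ℚ

eval : {V : Set} → Poly V → (V → Sign) → ℚ
eval p z = foldr (λ t r → proj₁ t ℚ.* evalMono z (proj₂ t) ℚ.+ r) 0ℚ p

degree : {V : Set} → Poly V → ℕ
degree = foldr (λ t d → length (proj₂ t) ℕ.⊔ d) 0

SignRep : {V : Set} → ((V → Sign) → Sign) → Poly V → Set
SignRep h p = ∀ z → 0ℚ ℚ.< signℚ (h z) ℚ.* eval p z

FG : (n : ℕ) → ((Fin n × Fin n) ⊎ Fin (ceilSqrt n) → Sign) → Sign
FG n = fFun n ∧F MAJ (ceilSqrt n)

{-# OPTIONS --safe #-}

-- Upper bound: 1 + [MAJ(y) is true] · Σ 2^i x_ij sign-represents f ∧ g, and the bracket is a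
-- polynomial of degree m = ⌈√n⌉ in y.
--
-- Lower bound: let p(x, y) of degree d sign-represent f ∧ g, and let |x_i| be the number of
-- entries +1 in the i-th row.  Write an integer W as Σ 2^i |x_i| by choosing the rows from the
-- lowest one upwards, each uniformly among the vectors of the parity forced by the rest of W.
-- Since d < n, parity does not affect moments of order at most d, so the average of p(x, y) over
-- these x is a polynomial in W of degree at most d.  Centring W gives P(u, y) = Σ a_j(y) u^j with
-- the signs of f ∧ g at all integers |u| ≤ 2^(n-1), where u ≥ 0 means that f is false.
-- Put M_j = Σ_y |a_j(y)|.  Among about 2d powers u of a number B ≈ 2^(n/2d) there is one at which
-- a single term M_j u^j exceeds all the others by a factor B (Newton polygon and pigeonhole).
-- Comparing u with -u, for j odd on the y with MAJ(y) false and for j even on the y with MAJ(y)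
-- true, shows |a_j(y)| ≤ M_j (d + 1) / B there.  As deg a_j ≤ d < m / 2, extrapolation bounds a_j
-- on the whole cube by 3^m times as much, so M_j ≤ 6^m (d + 1) M_j / B, which is impossible for
-- d ≤ ε √n since then B is larger than any fixed power of 2^m.
module Submission where

open import Defs

module ThresholdDegree where
  open import Level using (0ℓ)
  open import Data.Bool using (Bool; true; false; not)
  open import Data.Empty using (⊥; ⊥-elim)
  open import Data.Fin as Fin using (Fin; toℕ; combine)
  open import Data.Integer as ℤ using (ℤ)
  open import Data.Integer.DivMod using (_%ℕ_; _/ℕ_; a≡a%ℕn+[a/ℕn]*n; n%ℕd<d)
  import Data.Integer.Properties as ℤₚ
  import Data.Integer.Tactic.RingSolver as ℤ-Solver
  open import Data.List as List using (List; allFin; length)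
  import Data.List.Properties as Listₚ
  open import Data.Maybe using (Maybe; just; nothing)
  open import Data.Nat as ℕ using (ℕ; zero; suc; pred; _∸_)
  import Data.Nat.Properties as ℕₚ
  import Data.Nat.Tactic.RingSolver as ℕ-Solver
  open import Data.Product using (Σ; _×_; _,_; proj₁; proj₂)
  open import Data.Rational as ℚ using (ℚ; 0ℚ; 1ℚ; ½; _+_; _*_; _-_; -_; _≤_; _<_; ∣_∣)
  open import Data.Rational.Literals using (fromℤ)
  open import Data.Rational.Properties
  open import Data.Sign using (Sign) renaming (- to s-; + to s+)
  open import Data.Sum using (_⊎_; inj₁; inj₂)
  open import Data.Unit using (⊤; tt)
  open import Data.Vec as Vec using (Vec; []; _∷_; _++_; lookup; splitAt)
  open import Data.Vec.Properties using (lookup-++ˡ; lookup-++ʳ; lookup-map; lookup∘tabulate)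
  open import Function using (_∘_; id)
  open import Relation.Binary using (tri<; tri≈; tri>)
  open import Relation.Binary.PropositionalEquality
  open import Relation.Nullary using (yes; no)
  open import Tactic.RingSolver using (solve-∀)
  open import Tactic.RingSolver.Core.AlmostCommutativeRing using (AlmostCommutativeRing; fromCommutativeRing)

  -- Univariate polynomial functions over the rationals.

  ℚ-ring : AlmostCommutativeRing 0ℓ 0ℓ
  ℚ-ring = fromCommutativeRing +-*-commutativeRing isZero
    where
    isZero : ∀ x → Maybe (0ℚ ≡ x)
    isZero x with 0ℚ ≟ x
    ... | yes p = just p
    ... | no _  = nothing

  -- Throughout, the index e stands for degree < e: it is 0 for the zero function, and a
  -- difference operator takes e to pred e.
  PolyLt : ℕ → (ℚ → ℚ) → Set
  PolyLt zero    f = ∀ c → f c ≡ 0ℚ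
  PolyLt (suc e) f = Σ ℚ λ a → Σ (ℚ → ℚ) λ g → PolyLt e g × (∀ c → f c ≡ a + c * g c)

  poly-cong : ∀ e {f g} → (∀ c → f c ≡ g c) → PolyLt e f → PolyLt e g
  poly-cong zero    eq h           = λ c → trans (sym (eq c)) (h c)
  poly-cong (suc e) eq (a , k , h , s) = a , k , h , λ c → trans (sym (eq c)) (s c)

  poly-zero : ∀ e → PolyLt e (λ _ → 0ℚ)
  poly-zero zero    = λ _ → refl
  poly-zero (suc e) = 0ℚ , (λ _ → 0ℚ) , poly-zero e , solve-∀ ℚ-ring

  poly-const : ∀ e a → PolyLt (suc e) (λ _ → a)
  poly-const e a = a , (λ _ → 0ℚ) , poly-zero e , (λ c → lem a c)
    where
    lem : ∀ a c → a ≡ a + c * 0ℚ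
    lem = solve-∀ ℚ-ring

  poly-add : ∀ e {f g} → PolyLt e f → PolyLt e g → PolyLt e (λ c → f c + g c)
  poly-add zero    p q = λ c → trans (cong₂ _+_ (p c) (q c)) refl
  poly-add (suc e) (a , f , p , s) (b , g , q , t) =
    a + b , (λ c → f c + g c) , poly-add e p q ,
    λ c → trans (cong₂ _+_ (s c) (t c)) (lem a b c (f c) (g c))
    where
    lem : ∀ a b c x y → (a + c * x) + (b + c * y) ≡ (a + b) + c * (x + y)
    lem = solve-∀ ℚ-ring

  poly-scale : ∀ e k {f} → PolyLt e f → PolyLt e (λ c → k * f c)
  poly-scale zero    k p = λ c → trans (cong (k *_) (p c)) (*-zeroʳ k)
  poly-scale (suc e) k (a , f , p , s) =
    k * a , (λ c → k * f c) , poly-scale e k p ,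
    λ c → trans (cong (k *_) (s c)) (lem k a c (f c))
    where
    lem : ∀ k a c x → k * (a + c * x) ≡ k * a + c * (k * x)
    lem = solve-∀ ℚ-ring

  poly-sub : ∀ e {f g} → PolyLt e f → PolyLt e g → PolyLt e (λ c → f c - g c)
  poly-sub e {f} {g} p q = poly-cong e (λ c → lem (f c) (g c)) (poly-add e p (poly-scale e (- 1ℚ) q))
    where
    lem : ∀ x y → x + - 1ℚ * y ≡ x - y
    lem = solve-∀ ℚ-ring

  poly-X* : ∀ e {f} → PolyLt e f → PolyLt (suc e) (λ c → c * f c)
  poly-X* e {f} p = 0ℚ , f , p , (λ c → sym (+-identityˡ (c * f c)))

  poly-X*-pred : ∀ e {f} → PolyLt (pred e) f → PolyLt e (λ c → c * f c)
  poly-X*-pred zero    p = λ c → trans (cong (c *_) (p c)) (*-zeroʳ c)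
  poly-X*-pred (suc e) p = poly-X* e p

  poly-weaken : ∀ e {f} → PolyLt e f → PolyLt (suc e) f
  poly-weaken zero    p = poly-cong 1 (λ c → sym (p c)) (poly-zero 1)
  poly-weaken (suc e) (a , g , p , s) = a , g , poly-weaken e p , s

  -- In Horner form f(kc + l) = a + k · c · g(kc + l) + l · g(kc + l), and only the middle term uses
  -- up the extra degree. Covers the halving, the shift by one and the change of origin that occur
  -- later.
  poly-affine : ∀ e k l {f} → PolyLt e f → PolyLt e (λ c → f (k * c + l))
  poly-affine zero    k l p = λ c → p (k * c + l)
  poly-affine (suc e) k l (a , g , p , s) =
    poly-cong (suc e) (λ c → trans (lem a k l c (g (k * c + l))) (sym (s (k * c + l))))
      (poly-add (suc e) (poly-const e a)
        (poly-add (suc e) (poly-scale (suc e) k (poly-X* e q)) (poly-weaken e (poly-scale e l q))))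
    where
    q = poly-affine e k l p
    lem : ∀ a k l c x → a + (k * (c * x) + l * x) ≡ a + (k * c + l) * x
    lem = solve-∀ ℚ-ring

  poly-shift : ∀ e {f} → PolyLt e f → PolyLt e (λ c → f (c - 1ℚ))
  poly-shift e {f} p = poly-cong e (λ c → cong f (lem c)) (poly-affine e 1ℚ (- 1ℚ) p)
    where
    lem : ∀ c → 1ℚ * c + - 1ℚ ≡ c - 1ℚ
    lem = solve-∀ ℚ-ring

  -- For f = a + c g the difference is c (g(c - 1) - g(c)) - g(c - 1); the bracket has lost a degree
  -- by induction, and the factor c gives it back.
  poly-diff : ∀ e {f} → PolyLt e f → PolyLt (pred e) (λ c → f (c - 1ℚ) - f c)
  poly-diff zero    p = λ c → cong₂ _-_ (p (c - 1ℚ)) (p c)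
  poly-diff (suc e) (a , g , p , s) =
    poly-cong e (λ c → trans (lem a c (g (c - 1ℚ)) (g c)) (sym (cong₂ _-_ (s (c - 1ℚ)) (s c))))
      (poly-sub e (poly-X*-pred e (poly-diff e p)) (poly-shift e p))
    where
    lem : ∀ a c x y → c * (x - y) - x ≡ (a + (c - 1ℚ) * x) - (a + c * y)
    lem = solve-∀ ℚ-ring

  -- Functions on the cube and their degree.

  -- The total degree, read off from the discrete derivatives.
  DegLt : ∀ {k} → ℕ → (Vec Sign k → ℚ) → Set
  DegLt {zero}  zero    F = F [] ≡ 0ℚ
  DegLt {zero}  (suc e) F = ⊤
  DegLt {suc k} e       F =
    DegLt e (λ v → F (s- ∷ v)) × DegLt (pred e) (λ v → F (s+ ∷ v) - F (s- ∷ v))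

  deg-cong : ∀ {k} e {F G : Vec Sign k → ℚ} → (∀ v → F v ≡ G v) → DegLt e F → DegLt e G
  deg-cong {zero}  zero    eq p = trans (sym (eq [])) p
  deg-cong {zero}  (suc e) eq p = tt
  deg-cong {suc k} e       eq (p , q) =
    deg-cong e (λ v → eq (s- ∷ v)) p ,
    deg-cong (pred e) (λ v → cong₂ _-_ (eq (s+ ∷ v)) (eq (s- ∷ v))) q

  deg-zero : ∀ {k} e → DegLt {k} e (λ _ → 0ℚ)
  deg-zero {zero}  zero    = refl
  deg-zero {zero}  (suc e) = tt
  deg-zero {suc k} e       = deg-zero e , deg-zero (pred e)

  deg-zero⁻¹ : ∀ {k} {F : Vec Sign k → ℚ} → DegLt 0 F → ∀ v → F v ≡ 0ℚ
  deg-zero⁻¹ p       []       = p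
  deg-zero⁻¹ (p , q) (s- ∷ v) = deg-zero⁻¹ p v
  deg-zero⁻¹ {F = F} (p , q) (s+ ∷ v) =
    trans (lem (F (s+ ∷ v)) (F (s- ∷ v))) (cong₂ _+_ (deg-zero⁻¹ q v) (deg-zero⁻¹ p v))
    where
    lem : ∀ a b → a ≡ (a - b) + b
    lem = solve-∀ ℚ-ring

  deg-const : ∀ {k} e a → DegLt {k} (suc e) (λ _ → a)
  deg-const {zero}  e a = tt
  deg-const {suc k} e a = deg-const e a , deg-cong e (λ _ → sym (+-inverseʳ a)) (deg-zero e)

  deg-add : ∀ {k} e {F G : Vec Sign k → ℚ} → DegLt e F → DegLt e G → DegLt e (λ v → F v + G v)
  deg-add {zero}  zero    p q = cong₂ _+_ p q
  deg-add {zero}  (suc e) p q = tt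
  deg-add {suc k} e {F} {G} (p , q) (p' , q') =
    deg-add e p p' ,
    deg-cong (pred e) (λ v → lem (F (s+ ∷ v)) (F (s- ∷ v)) (G (s+ ∷ v)) (G (s- ∷ v)))
      (deg-add (pred e) q q')
    where
    lem : ∀ a b c d → (a - b) + (c - d) ≡ (a + c) - (b + d)
    lem = solve-∀ ℚ-ring

  deg-scale : ∀ {k} e x {F : Vec Sign k → ℚ} → DegLt e F → DegLt e (λ v → x * F v)
  deg-scale {zero}  zero    x p = trans (cong (x *_) p) (*-zeroʳ x)
  deg-scale {zero}  (suc e) x p = tt
  deg-scale {suc k} e       x {F} (p , q) =
    deg-scale e x p ,
    deg-cong (pred e) (λ v → lem x (F (s+ ∷ v)) (F (s- ∷ v))) (deg-scale (pred e) x q)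
    where
    lem : ∀ x a b → x * (a - b) ≡ x * a - x * b
    lem = solve-∀ ℚ-ring

  deg-weaken : ∀ {k} e {F : Vec Sign k → ℚ} → DegLt e F → DegLt (suc e) F
  deg-weaken {zero}  e       p       = tt
  deg-weaken {suc k} zero    (p , q) = deg-weaken zero p , q
  deg-weaken {suc k} (suc e) (p , q) = deg-weaken (suc e) p , deg-weaken e q

  deg-unpred : ∀ {k} e {F : Vec Sign k → ℚ} → DegLt (pred e) F → DegLt e F
  deg-unpred zero    p = p
  deg-unpred (suc e) p = deg-weaken e p

  deg-mono : ∀ {k} {d e} {F : Vec Sign k → ℚ} → d ℕ.≤ e → DegLt d F → DegLt e F
  deg-mono {d = d} {e} {F} d≤e p = go (ℕₚ.≤⇒≤′ d≤e)
    where
    go : ∀ {e} → d ℕ.≤′ e → DegLt e F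
    go ℕ.≤′-refl     = p
    go {suc e} (ℕ.≤′-step q) = deg-weaken e (go q)

  deg-plus : ∀ {k} e {F : Vec Sign (suc k) → ℚ} → DegLt e F → DegLt e (λ v → F (s+ ∷ v))
  deg-plus e {F} (p , q) =
    deg-cong e (λ v → lem (F (s- ∷ v)) (F (s+ ∷ v))) (deg-add e p (deg-unpred e q))
    where
    lem : ∀ a b → a + (b - a) ≡ b
    lem = solve-∀ ℚ-ring

  deg-restrict : ∀ {k} e s {F : Vec Sign (suc k) → ℚ} → DegLt e F → DegLt e (λ v → F (s ∷ v))
  deg-restrict e s- p = proj₁ p
  deg-restrict e s+ {F} p = deg-plus e {F} p

  deg-++ : ∀ {k r} e {F : Vec Sign (r ℕ.+ k) → ℚ} → DegLt e F →
           ∀ (x : Vec Sign r) → DegLt e (λ v → F (x ++ v))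
  deg-++ e p []      = p
  deg-++ e {F} p (s ∷ x) = deg-++ e (deg-restrict e s {F} p) x

  -- For the first variable, the derivative of x F is F(+1) + F(-1), that is, the derivative of F
  -- plus twice F(-1). A later variable commutes with the derivative in the first.
  deg-var : ∀ {k} e (i : Fin k) {F : Vec Sign k → ℚ} →
            DegLt e F → DegLt (suc e) (λ v → signℚ (lookup v i) * F v)
  deg-var e Fin.zero {F} (p , q) =
    deg-weaken e (deg-scale e (- 1ℚ) p) ,
    deg-cong e (λ v → lem (F (s+ ∷ v)) (F (s- ∷ v)))
      (deg-add e (deg-unpred e q) (deg-add e p p))
    where
    lem : ∀ a b → (a - b) + (b + b) ≡ 1ℚ * a - - 1ℚ * b
    lem = solve-∀ ℚ-ring
  -- Recursing on `q` would yield index 1 where index 0 is asked for; the difference vanishes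
  -- identically, hence so does its multiple.
  deg-var zero (Fin.suc i) {F} (p , q) =
    deg-var zero i p ,
    deg-cong 0 (λ v → sym (trans (sym (lem (signℚ (lookup v i)) (F (s+ ∷ v)) (F (s- ∷ v))))
                                 (trans (cong (signℚ (lookup v i) *_) (deg-zero⁻¹ q v)) (*-zeroʳ (signℚ (lookup v i))))))
      (deg-zero 0)
    where
    lem : ∀ x a b → x * (a - b) ≡ x * a - x * b
    lem = solve-∀ ℚ-ring
  deg-var (suc e) (Fin.suc i) {F} (p , q) =
    deg-var (suc e) i p ,
    deg-cong (suc e) (λ v → lem (signℚ (lookup v i)) (F (s+ ∷ v)) (F (s- ∷ v))) (deg-var e i q)
    where
    lem : ∀ x a b → x * (a - b) ≡ x * a - x * b
    lem = solve-∀ ℚ-ring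

  -- Integers inside the rationals.

  fromℤ-+ : ∀ a b → fromℤ (a ℤ.+ b) ≡ fromℤ a + fromℤ b
  fromℤ-+ a b = trans (sym (↥p/↧p≡p (fromℤ (a ℤ.+ b))))
    (cong (ℚ._/ 1) (sym (cong₂ ℤ._+_ (ℤₚ.*-identityʳ a) (ℤₚ.*-identityʳ b))))

  fromℤ-* : ∀ a b → fromℤ (a ℤ.* b) ≡ fromℤ a * fromℤ b
  fromℤ-* a b = sym (↥p/↧p≡p (fromℤ (a ℤ.* b)))

  fromℤ-neg : ∀ a → fromℤ (ℤ.- a) ≡ - fromℤ a
  fromℤ-neg (ℤ.+ zero)     = refl
  fromℤ-neg (ℤ.+ suc n)    = refl
  fromℤ-neg (ℤ.-[1+ n ]) = refl

  fromℤ-< : ∀ {a b} → a ℤ.< b → fromℤ a < fromℤ b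
  fromℤ-< {a} {b} a<b = ℚ.*<* (subst₂ ℤ._<_ (sym (ℤₚ.*-identityʳ a)) (sym (ℤₚ.*-identityʳ b)) a<b)

  fromℤ-≤ : ∀ {a b} → a ℤ.≤ b → fromℤ a ≤ fromℤ b
  fromℤ-≤ {a} {b} a≤b = ℚ.*≤* (subst₂ ℤ._≤_ (sym (ℤₚ.*-identityʳ a)) (sym (ℤₚ.*-identityʳ b)) a≤b)

  fromℕ : ℕ → ℚ
  fromℕ n = fromℤ (ℤ.+ n)

  fromℕ-suc : ∀ n → fromℕ (suc n) ≡ 1ℚ + fromℕ n
  fromℕ-suc n = fromℤ-+ (ℤ.+ 1) (ℤ.+ n)

  +-pos : ∀ {a b} → 0ℚ < a → 0ℚ < b → 0ℚ < a + b
  +-pos p q = +-mono-< p q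

  *-pos : ∀ {a b} → 0ℚ < a → 0ℚ < b → 0ℚ < a * b
  *-pos {a} {b} p q = subst (_< a * b) (*-zeroʳ a) (*-monoʳ-<-pos a {{ℚ.positive p}} q)

  -- Symmetrization operators, and averaging over a level of the cube.

  -- Keeps of an averaging operator what the induction over the rows needs: linearity, and that the
  -- degree in the bits bounds the degree in the new variable. Positivity holds only at particular
  -- integers and is proved separately.
  record Symmetrization (k : ℕ) : Set where
    field
      ap       : (Vec Sign k → ℚ) → ℚ → ℚ
      ap-cong  : ∀ {F G} → (∀ v → F v ≡ G v) → ∀ c → ap F c ≡ ap G c
      ap-add   : ∀ F G c → ap (λ v → F v + G v) c ≡ ap F c + ap G c
      ap-scale : ∀ x F c → ap (λ v → x * F v) c ≡ x * ap F c
      ap-deg   : ∀ e {F} → DegLt e F → PolyLt e (ap F)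

    ap-sub : ∀ F G c → ap (λ v → F v - G v) c ≡ ap F c - ap G c
    ap-sub F G c = trans (ap-cong (λ v → lem (F v) (G v)) c)
      (trans (ap-add F (λ v → - 1ℚ * G v) c)
        (trans (cong (λ z → ap F c + z) (ap-scale (- 1ℚ) G c)) (sym (lem (ap F c) (ap G c)))))
      where
      lem : ∀ x y → x - y ≡ x + - 1ℚ * y
      lem = solve-∀ ℚ-ring

  open Symmetrization

  hit : Sign → Sign → ℕ
  hit s- s- = 1
  hit s- s+ = 0
  hit s+ s- = 0
  hit s+ s+ = 1

  -- The sign is a parameter because extrapolation starts once from the all-false point and once
  -- from the all-true point.
  occ : ∀ {m} → Sign → Vec Sign m → ℕ
  occ σ []      = 0
  occ σ (τ ∷ y) = hit σ τ ℕ.+ occ σ y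

  count : ∀ {m} → Vec Sign m → ℕ
  count = occ s+

  module TopRow where
    -- At an integer c in [0, r] this is a positive multiple of the average of F over the
    -- vectors with exactly c entries +1.
    levelSum : ∀ r → (Vec Sign (r ℕ.+ 0) → ℚ) → ℚ → ℚ
    levelSum zero    F c = F []
    levelSum (suc r) F c = (fromℕ (suc r) - c) * levelSum r (λ v → F (s- ∷ v)) c
                  + c * levelSum r (λ v → F (s+ ∷ v)) (c - 1ℚ)

    levelSum-cong : ∀ r {F G} → (∀ v → F v ≡ G v) → ∀ c → levelSum r F c ≡ levelSum r G c
    levelSum-cong zero    eq c = eq []
    levelSum-cong (suc r) eq c = cong₂ (λ x y → (fromℕ (suc r) - c) * x + c * y)
      (levelSum-cong r (λ v → eq (s- ∷ v)) c) (levelSum-cong r (λ v → eq (s+ ∷ v)) (c - 1ℚ))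

    levelSum-add : ∀ r F G c → levelSum r (λ v → F v + G v) c ≡ levelSum r F c + levelSum r G c
    levelSum-add zero    F G c = refl
    levelSum-add (suc r) F G c =
      trans (cong₂ (λ x y → (fromℕ (suc r) - c) * x + c * y)
              (levelSum-add r (λ v → F (s- ∷ v)) (λ v → G (s- ∷ v)) c)
              (levelSum-add r (λ v → F (s+ ∷ v)) (λ v → G (s+ ∷ v)) (c - 1ℚ)))
            (lem (fromℕ (suc r) - c) c _ _ _ _)
      where
      lem : ∀ k c x y z w → k * (x + y) + c * (z + w) ≡ (k * x + c * z) + (k * y + c * w)
      lem = solve-∀ ℚ-ring

    levelSum-scale : ∀ r x F c → levelSum r (λ v → x * F v) c ≡ x * levelSum r F c
    levelSum-scale zero    x F c = refl
    levelSum-scale (suc r) x F c =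
      trans (cong₂ (λ a b → (fromℕ (suc r) - c) * a + c * b)
              (levelSum-scale r x (λ v → F (s- ∷ v)) c) (levelSum-scale r x (λ v → F (s+ ∷ v)) (c - 1ℚ)))
            (lem (fromℕ (suc r) - c) c x _ _)
      where
      lem : ∀ k c x a b → k * (x * a) + c * (x * b) ≡ x * (k * a + c * b)
      lem = solve-∀ ℚ-ring

    -- With F₀, F₁ the two restrictions and A the operator on `r` bits, the recursion reads (r + 1)
    -- A F₀(c) + c (A(F₁ - F₀)(c - 1) + A F₀(c - 1) - A F₀(c)), and the bracket is one degree lower.
    -- The proof comes after `top` so that `ap-sub` can be used in it.
    levelSum-deg : ∀ r e {F} → DegLt e F → PolyLt e (levelSum r F)

    top : ∀ r → Symmetrization (r ℕ.+ 0)
    top r = record { ap = levelSum r ; ap-cong = levelSum-cong r ; ap-add = levelSum-add r ; ap-scale = levelSum-scale r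
                   ; ap-deg = levelSum-deg r }

    levelSum-deg zero    zero    {F} p = λ _ → p
    levelSum-deg zero    (suc e) {F} p = poly-const e (F [])
    levelSum-deg (suc r) e {F} (p , q) =
      poly-cong e (λ c → trans
          (cong (λ x → fromℕ (suc r) * levelSum r F₀ c + c * (x + (levelSum r F₀ (c - 1ℚ) - levelSum r F₀ c)))
                (ap-sub (top r) F₁ F₀ (c - 1ℚ)))
          (lem (fromℕ (suc r)) c (levelSum r F₀ c) (levelSum r F₁ (c - 1ℚ)) (levelSum r F₀ (c - 1ℚ))))
        (poly-add e (poly-scale e (fromℕ (suc r)) (levelSum-deg r e p))
          (poly-X*-pred e (poly-add (pred e) (poly-shift (pred e) (levelSum-deg r (pred e) q))
                                             (poly-diff e (levelSum-deg r e p)))))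
      where
      F₀ = λ v → F (s- ∷ v)
      F₁ = λ v → F (s+ ∷ v)
      lem : ∀ k c x y z → k * x + c * ((y - z) + (z - x)) ≡ (k - c) * x + c * y
      lem = solve-∀ ℚ-ring

    -- At c = w the weights r - w and w of the two branches are nonnegative, and a branch that would
    -- leave its range (the first at w = r, the second at w = 0) has weight 0 and drops out.
    levelSum-pos : ∀ r w → w ℕ.≤ r → ∀ F → (∀ v → count v ≡ w → 0ℚ < F v) → 0ℚ < levelSum r F (fromℕ w)

    plus-branch : ∀ r w → w ℕ.≤ r → ∀ F → (∀ v → count v ≡ suc w → 0ℚ < F v) →
                  0ℚ < fromℕ (suc w) * levelSum r (λ v → F (s+ ∷ v)) (fromℕ (suc w) - 1ℚ)

    levelSum-pos zero    zero    _ F pos = pos [] refl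
    levelSum-pos (suc r) zero    _ F pos =
      subst (0ℚ <_) (lem (fromℕ (suc r)) _ (levelSum r (λ v → F (s+ ∷ v)) (fromℕ zero - 1ℚ)))
        (*-pos (fromℤ-< {ℤ.+ 0} {ℤ.+ suc r} (ℤ.+<+ (ℕ.s≤s ℕ.z≤n)))
               (levelSum-pos r zero ℕ.z≤n _ (λ v eq → pos (s- ∷ v) eq)))
      where
      lem : ∀ k x y → k * x ≡ (k - 0ℚ) * x + 0ℚ * y
      lem = solve-∀ ℚ-ring
    levelSum-pos (suc r) (suc w) (ℕ.s≤s w≤r) F pos with ℕₚ.m≤n⇒m<n∨m≡n w≤r
    ... | inj₁ w<r  = +-pos (*-pos (fromℤ-diff w<r) (levelSum-pos r (suc w) w<r _ (λ v eq → pos (s- ∷ v) eq))) second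
      where
      c = fromℕ (suc w)
      fromℤ-diff : w ℕ.< r → 0ℚ < fromℕ (suc r) - c
      fromℤ-diff w<r = subst (_< fromℕ (suc r) - c) (+-inverseʳ c)
        (+-monoˡ-< (- c) (fromℤ-< (ℤ.+<+ (ℕ.s≤s w<r))))
      second = plus-branch r w w≤r F pos
    ... | inj₂ refl = subst (0ℚ <_) (lem (fromℕ (suc r)) _ _) (plus-branch r w w≤r F pos)
      where
      lem : ∀ k x y → y ≡ (k - k) * x + y
      lem = solve-∀ ℚ-ring

    plus-branch r w w≤r F pos = *-pos (fromℤ-< {ℤ.+ 0} (ℤ.+<+ (ℕ.s≤s ℕ.z≤n)))
      (subst (λ c → 0ℚ < levelSum r (λ v → F (s+ ∷ v)) c)
        (trans (lem (fromℕ w)) (cong (_- 1ℚ) (sym (fromℕ-suc w))))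
        (levelSum-pos r w w≤r _ (λ v eq → pos (s+ ∷ v) (cong suc eq))))
      where
      lem : ∀ x → x ≡ (1ℚ + x) - 1ℚ
      lem = solve-∀ ℚ-ring

  open TopRow

  -- Averaging one row over a parity class.

  -- The form `count x + 2 V` with count 0 or 1: it lets `paritySum-pos` treat a single remaining
  -- bit by `refl`.
  HasParity : Bool → ℤ → Set
  HasParity true  W = Σ ℤ λ V → W ≡ ℤ.+ 0 ℤ.+ ℤ.+ 2 ℤ.* V
  HasParity false W = Σ ℤ λ V → W ≡ ℤ.+ 1 ℤ.+ ℤ.+ 2 ℤ.* V

  parity-pred : ∀ ε W → HasParity ε W → HasParity (not ε) (W ℤ.- ℤ.+ 1)
  parity-pred true  W (V , refl) = V ℤ.- ℤ.+ 1 , lem V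
    where
    lem : ∀ V → ℤ.+ 0 ℤ.+ ℤ.+ 2 ℤ.* V ℤ.- ℤ.+ 1 ≡ ℤ.+ 1 ℤ.+ ℤ.+ 2 ℤ.* (V ℤ.- ℤ.+ 1)
    lem = ℤ-Solver.solve-∀
  parity-pred false W (V , refl) = V , lem V
    where
    lem : ∀ V → ℤ.+ 1 ℤ.+ ℤ.+ 2 ℤ.* V ℤ.- ℤ.+ 1 ≡ ℤ.+ 0 ℤ.+ ℤ.+ 2 ℤ.* V
    lem = ℤ-Solver.solve-∀

  ½-double : ∀ V → ½ * fromℤ (ℤ.+ 0 ℤ.+ ℤ.+ 2 ℤ.* V) ≡ fromℤ V
  ½-double V = trans
    (cong (½ *_) (trans (fromℤ-+ (ℤ.+ 0) (ℤ.+ 2 ℤ.* V)) (cong (0ℚ +_) (fromℤ-* (ℤ.+ 2) V))))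
    (lem (fromℤ V))
    where
    lem : ∀ x → ½ * (0ℚ + fromℤ (ℤ.+ 2) * x) ≡ x
    lem x = trans (cong (½ *_) (+-identityˡ (fromℤ (ℤ.+ 2) * x)))
              (trans (sym (*-assoc ½ (fromℤ (ℤ.+ 2)) x)) (*-identityˡ x))

  fromℤ-pred : ∀ W → fromℤ (W ℤ.- ℤ.+ 1) ≡ fromℤ W - 1ℚ
  fromℤ-pred W = fromℤ-+ W (ℤ.- ℤ.+ 1)

  parity : ∀ W → HasParity true W ⊎ HasParity false W
  parity W with W %ℕ 2 in eq | a≡a%ℕn+[a/ℕn]*n W 2 | n%ℕd<d W 2
  ... | 0           | d | _ = inj₁ (W /ℕ 2 , trans d (cong (λ z → ℤ.+ 0 ℤ.+ z) (ℤₚ.*-comm (W /ℕ 2) (ℤ.+ 2))))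
  ... | 1           | d | _ = inj₂ (W /ℕ 2 , trans d (cong (λ z → ℤ.+ 1 ℤ.+ z) (ℤₚ.*-comm (W /ℕ 2) (ℤ.+ 2))))
  ... | suc (suc r) | d | ℕ.s≤s (ℕ.s≤s ())

  module Row {k : ℕ} (R : Symmetrization k) where
    -- At an integer c of parity ε (true for even) this is a sum over the first r bits x with
    -- c - |x| even.  If deg F < r, the result does not depend on ε.
    paritySum : ∀ r → Bool → (Vec Sign (r ℕ.+ k) → ℚ) → ℚ → ℚ
    paritySum zero    true  F c = ap R F (½ * c)
    paritySum zero    false F c = 0ℚ
    paritySum (suc r) ε     F c = paritySum r ε (λ v → F (s- ∷ v)) c + paritySum r (not ε) (λ v → F (s+ ∷ v)) (c - 1ℚ)

    paritySum-cong : ∀ r ε {F G} → (∀ v → F v ≡ G v) → ∀ c → paritySum r ε F c ≡ paritySum r ε G c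
    paritySum-cong zero    true  eq c = ap-cong R eq (½ * c)
    paritySum-cong zero    false eq c = refl
    paritySum-cong (suc r) ε     eq c = cong₂ _+_ (paritySum-cong r ε (λ v → eq (s- ∷ v)) c)
                                          (paritySum-cong r (not ε) (λ v → eq (s+ ∷ v)) (c - 1ℚ))

    paritySum-add : ∀ r ε F G c → paritySum r ε (λ v → F v + G v) c ≡ paritySum r ε F c + paritySum r ε G c
    paritySum-add zero    true  F G c = ap-add R F G (½ * c)
    paritySum-add zero    false F G c = refl
    paritySum-add (suc r) ε     F G c = trans
      (cong₂ _+_ (paritySum-add r ε (λ v → F (s- ∷ v)) (λ v → G (s- ∷ v)) c)
                 (paritySum-add r (not ε) (λ v → F (s+ ∷ v)) (λ v → G (s+ ∷ v)) (c - 1ℚ)))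
      (lem (paritySum r ε (λ v → F (s- ∷ v)) c) (paritySum r ε (λ v → G (s- ∷ v)) c)
           (paritySum r (not ε) (λ v → F (s+ ∷ v)) (c - 1ℚ)) (paritySum r (not ε) (λ v → G (s+ ∷ v)) (c - 1ℚ)))
      where
      lem : ∀ x y z w → (x + y) + (z + w) ≡ (x + z) + (y + w)
      lem = solve-∀ ℚ-ring

    paritySum-scale : ∀ r ε x F c → paritySum r ε (λ v → x * F v) c ≡ x * paritySum r ε F c
    paritySum-scale zero    true  x F c = ap-scale R x F (½ * c)
    paritySum-scale zero    false x F c = sym (*-zeroʳ x)
    paritySum-scale (suc r) ε     x F c = trans
      (cong₂ _+_ (paritySum-scale r ε x (λ v → F (s- ∷ v)) c) (paritySum-scale r (not ε) x (λ v → F (s+ ∷ v)) (c - 1ℚ)))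
      (sym (*-distribˡ-+ x _ _))

    paritySum-deg : ∀ r ε e {F} → DegLt e F → PolyLt e (paritySum r ε F)
    paritySum-deg zero    true  e {F} p = poly-cong e (λ c → cong (ap R F) (+-identityʳ (½ * c)))
                                    (poly-affine e ½ 0ℚ (ap-deg R e p))
    paritySum-deg zero    false e     p = poly-zero e
    paritySum-deg (suc r) ε     e {F} p = poly-add e (paritySum-deg r ε e {λ v → F (s- ∷ v)} (deg-restrict e s- {F} p))
      (poly-shift e (paritySum-deg r (not ε) e (deg-restrict e s+ {F} p)))

    row : ∀ r → Bool → Symmetrization (r ℕ.+ k)
    row r ε = record { ap = paritySum r ε ; ap-cong = paritySum-cong r ε ; ap-add = paritySum-add r ε
                     ; ap-scale = paritySum-scale r ε ; ap-deg = λ e → paritySum-deg r ε e }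

    -- Let D be the difference of the two parities on `r` bits. One more bit turns it into D F₀(c) -
    -- D F₁(c - 1) = (D F₀(c) - D F₀(c - 1)) - D(F₁ - F₀)(c - 1), and either part has lost a degree.
    -- This is the vanishing of alternating sums over the cube on low degree.
    paritySum-diff : ∀ r e {F} → DegLt e F → PolyLt (e ∸ r) (λ c → paritySum r true F c - paritySum r false F c)
    paritySum-diff zero    e {F} p =
      poly-cong e (λ c → sym (+-identityʳ (paritySum 0 true F c))) (paritySum-deg zero true e p)
    paritySum-diff (suc r) e {F} (p , q) =
      subst (λ d → PolyLt d (λ c → paritySum (suc r) true F c - paritySum (suc r) false F c)) (ℕₚ.pred[m∸n]≡m∸[1+n] e r)
        (poly-cong (pred (e ∸ r)) (λ c → trans
            (cong₂ (λ a b → - 1ℚ * A₀ c - (a - b)) (ap-sub (row r true) F₁ F₀ (c - 1ℚ))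
                                                 (ap-sub (row r false) F₁ F₀ (c - 1ℚ)))
            (lem (paritySum r true F₀ c) (paritySum r false F₀ c) (paritySum r true F₀ (c - 1ℚ)) (paritySum r false F₀ (c - 1ℚ))
                 (paritySum r true F₁ (c - 1ℚ)) (paritySum r false F₁ (c - 1ℚ))))
          (poly-sub _ (poly-scale _ (- 1ℚ) (poly-diff (e ∸ r) (paritySum-diff r e p)))
            (poly-shift _ (subst
              (λ d → PolyLt d (λ c → paritySum r true (λ v → F₁ v - F₀ v) c
                                     - paritySum r false (λ v → F₁ v - F₀ v) c))
              (pred-∸ e r) (paritySum-diff r (pred e) q)))))
      where
      F₀ = λ v → F (s- ∷ v)
      F₁ = λ v → F (s+ ∷ v)
      A₀ : ℚ → ℚ
      A₀ c = (paritySum r true F₀ (c - 1ℚ) - paritySum r false F₀ (c - 1ℚ)) - (paritySum r true F₀ c - paritySum r false F₀ c)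
      pred-∸ : ∀ e r → pred e ∸ r ≡ pred (e ∸ r)
      pred-∸ zero    zero    = refl
      pred-∸ zero    (suc r) = refl
      pred-∸ (suc e) r       = sym (ℕₚ.pred[m∸n]≡m∸[1+n] (suc e) r)
      lem : ∀ a b a' b' x y →
            - 1ℚ * ((a' - b') - (a - b)) - ((x - a') - (y - b')) ≡ (a + y) - (b + x)
      lem = solve-∀ ℚ-ring

    -- The index e - r of the difference is 0. Hence one polynomial serves the integers of both
    -- parities.
    paritySum-parity : ∀ r e {F} → e ℕ.≤ r → DegLt e F → ∀ c → paritySum r true F c ≡ paritySum r false F c
    paritySum-parity r e {F} e≤r p c = trans (lem _ _) (trans (cong (_+ paritySum r false F c) vanish) (+-identityˡ _))
      where
      vanish : paritySum r true F c - paritySum r false F c ≡ 0ℚ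
      vanish = subst (λ d → PolyLt d (λ c → paritySum r true F c - paritySum r false F c)) (ℕₚ.m≤n⇒m∸n≡0 e≤r) (paritySum-diff r e p) c
      lem : ∀ a b → a ≡ (a - b) + b
      lem = solve-∀ ℚ-ring

    -- A sum of positive terms. With `suc r` bits each parity class is nonempty, whereas with no
    -- bits the odd sum is empty and equals 0.
    paritySum-pos : ∀ r ε W → HasParity ε W → ∀ F →
            (∀ (x : Vec Sign (suc r)) V → W ≡ ℤ.+ count x ℤ.+ ℤ.+ 2 ℤ.* V →
               0ℚ < ap R (λ v → F (x ++ v)) (fromℤ V)) →
            0ℚ < paritySum (suc r) ε F (fromℤ W)
    paritySum-pos zero    true  W (V , refl) F h =
      subst (0ℚ <_) (sym (trans (+-identityʳ _) (cong (ap R (λ v → F (s- ∷ v))) (½-double V))))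
        (h (s- ∷ []) V refl)
    paritySum-pos zero    false W (V , refl) F h =
      subst (0ℚ <_) (sym (trans (+-identityˡ _)
          (cong (λ c → ap R (λ v → F (s+ ∷ v)) (½ * c)) (sym (fromℤ-pred W)) )))
        (subst (λ c → 0ℚ < ap R (λ v → F (s+ ∷ v)) c)
          (trans (sym (½-double V)) (cong (λ z → ½ * fromℤ z) (sym (lem V))))
          (h (s+ ∷ []) V refl))
      where
      lem : ∀ V → ℤ.+ 1 ℤ.+ ℤ.+ 2 ℤ.* V ℤ.- ℤ.+ 1 ≡ ℤ.+ 0 ℤ.+ ℤ.+ 2 ℤ.* V
      lem = ℤ-Solver.solve-∀
    paritySum-pos (suc r) ε     W par F h = +-pos
      (paritySum-pos r ε W par (λ v → F (s- ∷ v)) (λ x V eq → h (s- ∷ x) V eq))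
      (subst (λ c → 0ℚ < paritySum (suc r) (not ε) (λ v → F (s+ ∷ v)) c) (fromℤ-pred W)
        (paritySum-pos r (not ε) (W ℤ.- ℤ.+ 1) (parity-pred ε W par) (λ v → F (s+ ∷ v))
          (λ x V eq → h (s+ ∷ x) V (trans (lem W) (trans (cong (λ z → ℤ.+ 1 ℤ.+ z) eq)
            (sym (ℤₚ.+-assoc (ℤ.+ 1) (ℤ.+ count x) (ℤ.+ 2 ℤ.* V))))))))
      where
      lem : ∀ W → W ≡ ℤ.+ 1 ℤ.+ (W ℤ.- ℤ.+ 1)
      lem = ℤ-Solver.solve-∀

  open Row

  -- Integers as weighted row counts.

  module Weight (n′ : ℕ) where
    n = suc n′

    -- Vectors list the lowest row first.
    rowWeight : ∀ r {k} → (Vec Sign k → ℤ) → Vec Sign (r ℕ.+ k) → ℤ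
    rowWeight zero    g v        = ℤ.+ 2 ℤ.* g v
    rowWeight (suc r) g (s- ∷ v) = rowWeight r g v
    rowWeight (suc r) g (s+ ∷ v) = ℤ.+ 1 ℤ.+ rowWeight r g v

    -- Horner's scheme for the sum of 2^i |x_i|, with i from 0.
    weight : ∀ N → Vec Sign (N ℕ.* n) → ℤ
    weight zero    v = ℤ.+ 0
    weight (suc N) v = rowWeight n (weight N) v

    rowWeight-++ : ∀ {r k} (g : Vec Sign k → ℤ) (x : Vec Sign r) v →
                   rowWeight r g (x ++ v) ≡ ℤ.+ count x ℤ.+ ℤ.+ 2 ℤ.* g v
    rowWeight-++ g []       v = sym (ℤₚ.+-identityˡ _)
    rowWeight-++ g (s- ∷ x) v = rowWeight-++ g x v
    rowWeight-++ g (s+ ∷ x) v = trans (cong (λ z → ℤ.+ 1 ℤ.+ z) (rowWeight-++ g x v))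
      (sym (ℤₚ.+-assoc (ℤ.+ 1) (ℤ.+ count x) (ℤ.+ 2 ℤ.* g v)))

    rowWeight-count : ∀ r (v : Vec Sign (r ℕ.+ 0)) → rowWeight r (weight zero) v ≡ ℤ.+ count v
    rowWeight-count zero    []       = refl
    rowWeight-count (suc r) (s- ∷ v) = rowWeight-count r v
    rowWeight-count (suc r) (s+ ∷ v) = cong (λ z → ℤ.+ 1 ℤ.+ z) (rowWeight-count r v)

    count≤ : ∀ {r} (x : Vec Sign r) → count x ℕ.≤ r
    count≤ []       = ℕ.z≤n
    count≤ (s- ∷ x) = ℕₚ.m≤n⇒m≤1+n (count≤ x)
    count≤ (s+ ∷ x) = ℕ.s≤s (count≤ x)

    pow : ℕ → ℤ
    pow N = ℤ.+ (2 ℕ.^ N)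

    pow-suc : ∀ N → pow (suc N) ≡ ℤ.+ 2 ℤ.* pow N
    pow-suc N = ℤₚ.pos-* 2 (2 ℕ.^ N)

    -- The range of W in which every choice of the N lower rows (of the right parity)
    -- can be completed by a choice of the top row.
    Valid : ℕ → ℤ → Set
    Valid N W = (ℤ.+ n ℤ.* pow N ℤ.< W ℤ.+ pow N ℤ.+ ℤ.+ n) × (W ℤ.< (ℤ.+ 1 ℤ.+ ℤ.+ n) ℤ.* pow N)

    -- After W = w + 2V everything is halved: the lower bound uses w ≤ n, which together with its
    -- own slack n makes 2n, and the upper bound uses w ≥ 0.
    valid-half : ∀ N w V → w ℕ.≤ n → Valid (suc N) (ℤ.+ w ℤ.+ ℤ.+ 2 ℤ.* V) → Valid N V
    valid-half N w V w≤n (lo , hi) =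
      ℤₚ.*-cancelˡ-<-nonNeg (ℤ.+ 2) (begin-strict
        ℤ.+ 2 ℤ.* (ℤ.+ n ℤ.* P)       ≡⟨ l₁ (ℤ.+ n) P ⟩
        ℤ.+ n ℤ.* (ℤ.+ 2 ℤ.* P)       ≡⟨ cong (ℤ.+ n ℤ.*_) (pow-suc N) ⟨
        ℤ.+ n ℤ.* pow (suc N)         <⟨ lo ⟩
        ℤ.+ w ℤ.+ ℤ.+ 2 ℤ.* V ℤ.+ pow (suc N) ℤ.+ ℤ.+ n
          ≤⟨ ℤₚ.+-monoˡ-≤ (ℤ.+ n) (ℤₚ.+-monoˡ-≤ (pow (suc N)) (ℤₚ.+-monoˡ-≤ (ℤ.+ 2 ℤ.* V) (ℤ.+≤+ w≤n))) ⟩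
        ℤ.+ n ℤ.+ ℤ.+ 2 ℤ.* V ℤ.+ pow (suc N) ℤ.+ ℤ.+ n
          ≡⟨ cong (λ z → ℤ.+ n ℤ.+ ℤ.+ 2 ℤ.* V ℤ.+ z ℤ.+ ℤ.+ n) (pow-suc N) ⟩
        ℤ.+ n ℤ.+ ℤ.+ 2 ℤ.* V ℤ.+ ℤ.+ 2 ℤ.* P ℤ.+ ℤ.+ n
          ≡⟨ l₂ (ℤ.+ n) V P ⟩
        ℤ.+ 2 ℤ.* (V ℤ.+ P ℤ.+ ℤ.+ n) ∎) ,
      ℤₚ.*-cancelˡ-<-nonNeg (ℤ.+ 2) (begin-strict
        ℤ.+ 2 ℤ.* V                             ≡⟨ ℤₚ.+-identityˡ _ ⟨
        ℤ.+ 0 ℤ.+ ℤ.+ 2 ℤ.* V                   ≤⟨ ℤₚ.+-monoˡ-≤ (ℤ.+ 2 ℤ.* V) (ℤ.+≤+ {0} {w} ℕ.z≤n) ⟩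
        ℤ.+ w ℤ.+ ℤ.+ 2 ℤ.* V                   <⟨ hi ⟩
        (ℤ.+ 1 ℤ.+ ℤ.+ n) ℤ.* pow (suc N)       ≡⟨ cong ((ℤ.+ 1 ℤ.+ ℤ.+ n) ℤ.*_) (pow-suc N) ⟩
        (ℤ.+ 1 ℤ.+ ℤ.+ n) ℤ.* (ℤ.+ 2 ℤ.* P)     ≡⟨ l₁ (ℤ.+ 1 ℤ.+ ℤ.+ n) P ⟨
        ℤ.+ 2 ℤ.* ((ℤ.+ 1 ℤ.+ ℤ.+ n) ℤ.* P)     ∎)
      where
      open ℤₚ.≤-Reasoning
      P = pow N
      l₁ : ∀ a b → ℤ.+ 2 ℤ.* (a ℤ.* b) ≡ a ℤ.* (ℤ.+ 2 ℤ.* b)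
      l₁ = ℤ-Solver.solve-∀
      l₂ : ∀ a b c → a ℤ.+ ℤ.+ 2 ℤ.* b ℤ.+ ℤ.+ 2 ℤ.* c ℤ.+ a ≡ ℤ.+ 2 ℤ.* (b ℤ.+ c ℤ.+ a)
      l₂ = ℤ-Solver.solve-∀

    valid-zero : ∀ W → Valid 0 W → Σ ℕ λ w → (W ≡ ℤ.+ w) × (w ℕ.≤ n)
    valid-zero (ℤ.+ w) (_ , hi) =
      w , refl , ℕ.s≤s⁻¹ (ℤₚ.drop‿+<+ (subst (ℤ.+ w ℤ.<_) (ℤₚ.*-identityʳ (ℤ.+ suc n)) hi))
    valid-zero ℤ.-[1+ w ] (lo , _) = ⊥-elim (ℤₚ.<-irrefl refl (begin-strict
      ℤ.+ n                                         ≡⟨ ℤₚ.*-identityʳ (ℤ.+ n) ⟨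
      ℤ.+ n ℤ.* pow 0                               <⟨ lo ⟩
      ℤ.-[1+ w ] ℤ.+ ℤ.+ 1 ℤ.+ ℤ.+ n
        ≤⟨ ℤₚ.+-monoˡ-≤ (ℤ.+ n) (ℤₚ.+-monoˡ-≤ (ℤ.+ 1) (ℤ.-≤- {w} {0} ℕ.z≤n)) ⟩
      ℤ.+ 0 ℤ.+ ℤ.+ n                               ≡⟨ ℤₚ.+-identityˡ _ ⟩
      ℤ.+ n                                         ∎))
      where open ℤₚ.≤-Reasoning

    -- The top row must take up all that is left of W, hence a level of the cube; a lower row only
    -- has to match a parity. The flag is always `true`, which fixes one polynomial in W.
    sym-rows : ∀ N → Symmetrization (suc N ℕ.* n)
    sym-rows zero    = top n
    sym-rows (suc N) = row (sym-rows N) n true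

    -- Induction on the rows: after a choice x of the lowest row the others must have weight V = (W
    -- - |x|) / 2, again in range by `valid-half`. For odd W the flag is exchanged by
    -- `paritySum-parity`, which is where `e ≤ n` enters.
    sym-rows-pos : ∀ N e → e ℕ.≤ n → ∀ W → Valid N W → ∀ F → DegLt e F →
                   (∀ v → weight (suc N) v ≡ W → 0ℚ < F v) → 0ℚ < ap (sym-rows N) F (fromℤ W)
    sym-rows-pos zero    e e≤n W val F deg pos with valid-zero W val
    ... | w , refl , w≤n =
      levelSum-pos n w w≤n F (λ v eq → pos v (trans (rowWeight-count n v) (cong ℤ.+_ eq)))
    sym-rows-pos (suc N) e e≤n W val F deg pos = by-parity (parity W)
      where
      R = sym-rows N
      rest : ∀ (x : Vec Sign n) V → W ≡ ℤ.+ count x ℤ.+ ℤ.+ 2 ℤ.* V →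
             0ℚ < ap R (λ v → F (x ++ v)) (fromℤ V)
      rest x V eq = sym-rows-pos N e e≤n V
        (valid-half N (count x) V (count≤ x) (subst (Valid (suc N)) eq val))
        (λ v → F (x ++ v)) (deg-++ e {F} deg x)
        (λ v eq′ → pos (x ++ v) (trans (rowWeight-++ (weight (suc N)) x v)
          (trans (cong (λ z → ℤ.+ count x ℤ.+ ℤ.+ 2 ℤ.* z) eq′) (sym eq))))
      by-parity : _ → 0ℚ < paritySum R n true F (fromℤ W)
      by-parity (inj₁ even) = paritySum-pos R n′ true W even F rest
      by-parity (inj₂ odd)  = subst (0ℚ <_) (sym (paritySum-parity R n e {F} e≤n deg (fromℤ W)))
                                (paritySum-pos R n′ false W odd F rest)

  -- Powers and order in the rationals.

  infixr 8 _^^_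
  _^^_ : ℚ → ℕ → ℚ
  x ^^ zero  = 1ℚ
  x ^^ suc n = x * x ^^ n

  2ℚ 3ℚ : ℚ
  2ℚ = 1ℚ + 1ℚ
  3ℚ = 1ℚ + 2ℚ

  *-mono : ∀ {k a b} → 0ℚ ≤ k → a ≤ b → k * a ≤ k * b
  *-mono {k} 0≤k a≤b = *-monoˡ-≤-nonNeg k {{ℚ.nonNegative 0≤k}} a≤b

  *-nonneg : ∀ {a b} → 0ℚ ≤ a → 0ℚ ≤ b → 0ℚ ≤ a * b
  *-nonneg {a} {b} 0≤a 0≤b = subst (_≤ a * b) (*-zeroʳ a) (*-mono 0≤a 0≤b)

  0<1 : 0ℚ < 1ℚ
  0<1 = fromℤ-< {ℤ.+ 0} {ℤ.+ 1} (ℤ.+<+ (ℕ.s≤s ℕ.z≤n))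

  0≤1 : 0ℚ ≤ 1ℚ
  0≤1 = <⇒≤ 0<1

  0≤2 : 0ℚ ≤ 2ℚ
  0≤2 = +-mono-≤ 0≤1 0≤1

  ^^-nonneg : ∀ {x} n → 0ℚ ≤ x → 0ℚ ≤ x ^^ n
  ^^-nonneg zero    p = 0≤1
  ^^-nonneg (suc n) p = *-nonneg p (^^-nonneg n p)

  ^^-pos : ∀ {x} n → 0ℚ < x → 0ℚ < x ^^ n
  ^^-pos zero    p = 0<1
  ^^-pos (suc n) p = *-pos p (^^-pos n p)

  ^^-mono : ∀ {x} → 1ℚ ≤ x → ∀ {i j} → i ℕ.≤ j → x ^^ i ≤ x ^^ j
  ^^-mono {x} 1≤x {j = zero}  ℕ.z≤n       = ≤-refl
  ^^-mono {x} 1≤x {j = suc j} ℕ.z≤n       = begin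
    1ℚ            ≤⟨ ^^-mono 1≤x {j = j} ℕ.z≤n ⟩
    x ^^ j        ≡⟨ *-identityˡ _ ⟨
    1ℚ * x ^^ j   ≤⟨ *-monoʳ-≤-nonNeg (x ^^ j) {{ℚ.nonNegative (^^-nonneg j (≤-trans 0≤1 1≤x))}} 1≤x ⟩
    x * x ^^ j    ∎
    where open ≤-Reasoning
  ^^-mono {x} 1≤x         (ℕ.s≤s i≤j) = *-mono (≤-trans 0≤1 1≤x) (^^-mono 1≤x i≤j)

  -- Extrapolation from a Hamming ball to the cube.

  triple : ∀ k x → k * x + k * (x + x) ≡ (3ℚ * k) * x
  triple = solve-∀ ℚ-ring

  -- A function of degree < e is determined by its values on the ball of radius e - 1 around the
  -- point without `σ`. The restriction of the first bit to the other sign keeps e and η, and the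
  -- discrete derivative has index pred e and bound 2η; adding the two gives a factor 3 per bit.
  extrapolate : ∀ σ {m} e {F : Vec Sign m → ℚ} {η} → 0ℚ ≤ η → DegLt e F →
                (∀ y → occ σ y ℕ.< e → ∣ F y ∣ ≤ η) → ∀ y → ∣ F y ∣ ≤ 3ℚ ^^ m * η

  private
    -- `F₀` and `F₁` are the restrictions to a first bit different from and equal to `σ`; stated for
    -- two functions so that both values of `σ` share it.
    extrapolate-step : ∀ σ {m} e {F₀ F₁ : Vec Sign m → ℚ} {η} → 0ℚ ≤ η →
      DegLt e F₀ → DegLt (pred e) (λ y → F₁ y - F₀ y) →
      (∀ y → occ σ y ℕ.< e → ∣ F₀ y ∣ ≤ η) → (∀ y → suc (occ σ y) ℕ.< e → ∣ F₁ y ∣ ≤ η) →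
      ∀ y → (∣ F₀ y ∣ ≤ 3ℚ ^^ suc m * η) × (∣ F₁ y ∣ ≤ 3ℚ ^^ suc m * η)
    extrapolate-step σ {m} e {F₀} {F₁} {η} 0≤η p q h₀ h₁ y =
        (begin
          ∣ F₀ y ∣                      ≤⟨ b₀ ⟩
          K * η                         ≡⟨ +-identityʳ _ ⟨
          K * η + 0ℚ                    ≤⟨ +-monoʳ-≤ (K * η) (*-nonneg 0≤K (+-mono-≤ 0≤η 0≤η)) ⟩
          K * η + K * (η + η)           ≡⟨ triple K η ⟩
          3ℚ ^^ suc m * η               ∎) ,
        (begin
          ∣ F₁ y ∣                      ≡⟨ cong ∣_∣ (lem (F₀ y) (F₁ y)) ⟩
          ∣ F₀ y + (F₁ y - F₀ y) ∣      ≤⟨ ∣p+q∣≤∣p∣+∣q∣ (F₀ y) (F₁ y - F₀ y) ⟩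
          ∣ F₀ y ∣ + ∣ F₁ y - F₀ y ∣    ≤⟨ +-mono-≤ b₀ b₁ ⟩
          K * η + K * (η + η)           ≡⟨ triple K η ⟩
          3ℚ ^^ suc m * η               ∎)
      where
      open ≤-Reasoning
      K = 3ℚ ^^ m
      0≤K : 0ℚ ≤ K
      0≤K = ^^-nonneg m (+-mono-≤ 0≤1 0≤2)
      b₀ : ∣ F₀ y ∣ ≤ K * η
      b₀ = extrapolate σ e 0≤η p h₀ y
      suc-< : ∀ {a} e → a ℕ.< pred e → suc a ℕ.< e
      suc-< (suc e) lt = ℕ.s≤s lt
      b₁ : ∣ F₁ y - F₀ y ∣ ≤ K * (η + η)
      b₁ = extrapolate σ (pred e) (+-mono-≤ 0≤η 0≤η) q
        (λ z lt → ≤-trans (∣p-q∣≤∣p∣+∣q∣ (F₁ z) (F₀ z))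
          (+-mono-≤ (h₁ z (suc-< e lt)) (h₀ z (ℕₚ.<-trans (ℕₚ.n<1+n _) (suc-< e lt))))) y
      lem : ∀ a b → b ≡ a + (b - a)
      lem = solve-∀ ℚ-ring

  extrapolate σ {m} zero 0≤η p h y =
    subst (_≤ _) (sym (cong ∣_∣ (deg-zero⁻¹ p y))) (*-nonneg (^^-nonneg m (+-mono-≤ 0≤1 0≤2)) 0≤η)
  extrapolate σ {zero} (suc e) {F} {η} 0≤η p h [] =
    subst (∣ F [] ∣ ≤_) (sym (*-identityˡ η)) (h [] (ℕ.s≤s ℕ.z≤n))
  extrapolate s+ {suc m} e@(suc _) {F} 0≤η p h (τ ∷ y) = pick τ
    where
    both = extrapolate-step s+ e {F₀ = λ v → F (s- ∷ v)} {λ v → F (s+ ∷ v)} 0≤η (proj₁ p) (proj₂ p)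
             (λ z → h (s- ∷ z)) (λ z → h (s+ ∷ z)) y
    pick : ∀ τ → ∣ F (τ ∷ y) ∣ ≤ 3ℚ ^^ suc m * _
    pick s- = proj₁ both
    pick s+ = proj₂ both
  extrapolate s- {suc m} e@(suc e′) {F} 0≤η p h (τ ∷ y) = pick τ
    where
    lem : ∀ a b → - 1ℚ * (a - b) ≡ b - a
    lem = solve-∀ ℚ-ring
    -- The base is now the restriction to +, so the derivative appears with the opposite sign.
    both = extrapolate-step s- e {F₀ = λ v → F (s+ ∷ v)} {λ v → F (s- ∷ v)} 0≤η
             (deg-restrict e s+ {F} p)
             (deg-cong e′ (λ v → lem (F (s+ ∷ v)) (F (s- ∷ v))) (deg-scale e′ (- 1ℚ) (proj₂ p)))
             (λ z → h (s+ ∷ z)) (λ z → h (s- ∷ z)) y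
    pick : ∀ τ → ∣ F (τ ∷ y) ∣ ≤ 3ℚ ^^ suc m * _
    pick s- = proj₂ both
    pick s+ = proj₁ both

  -- The sum norm on the cube.

  norm : ∀ {m} → (Vec Sign m → ℚ) → ℚ
  norm {zero}  F = ∣ F [] ∣
  norm {suc m} F = norm (λ v → F (s- ∷ v)) + norm (λ v → F (s+ ∷ v))

  norm-nonneg : ∀ {m} (F : Vec Sign m → ℚ) → 0ℚ ≤ norm F
  norm-nonneg {zero}  F = 0≤∣p∣ (F [])
  norm-nonneg {suc m} F = +-mono-≤ (norm-nonneg (λ v → F (s- ∷ v))) (norm-nonneg (λ v → F (s+ ∷ v)))

  ∣∣≤norm : ∀ {m} (F : Vec Sign m → ℚ) y → ∣ F y ∣ ≤ norm F
  ∣∣≤norm F []       = ≤-refl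
  ∣∣≤norm F (s- ∷ y) = subst (_≤ _) (+-identityʳ _)
    (+-mono-≤ (∣∣≤norm (λ v → F (s- ∷ v)) y) (norm-nonneg (λ v → F (s+ ∷ v))))
  ∣∣≤norm F (s+ ∷ y) = subst (_≤ _) (+-identityˡ _)
    (+-mono-≤ (norm-nonneg (λ v → F (s- ∷ v))) (∣∣≤norm (λ v → F (s+ ∷ v)) y))

  norm≤ : ∀ {m} (F : Vec Sign m → ℚ) {K} → (∀ y → ∣ F y ∣ ≤ K) → norm F ≤ 2ℚ ^^ m * K
  norm≤ {zero}  F {K} h = subst (∣ F [] ∣ ≤_) (sym (*-identityˡ K)) (h [])
  norm≤ {suc m} F {K} h = subst (norm F ≤_) (lem (2ℚ ^^ m) K)
    (+-mono-≤ (norm≤ (λ v → F (s- ∷ v)) (λ y → h (s- ∷ y))) (norm≤ (λ v → F (s+ ∷ v)) (λ y → h (s+ ∷ y))))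
    where
    lem : ∀ k x → k * x + k * x ≡ (2ℚ * k) * x
    lem = solve-∀ ℚ-ring

  norm-scale : ∀ {m} x → 0ℚ ≤ x → ∀ (F : Vec Sign m → ℚ) → norm (λ y → x * F y) ≡ x * norm F
  norm-scale {zero}  x p F = trans (∣p*q∣≡∣p∣*∣q∣ x (F [])) (cong (_* ∣ F [] ∣) (0≤p⇒∣p∣≡p p))
  norm-scale {suc m} x p F = trans
    (cong₂ _+_ (norm-scale x p (λ v → F (s- ∷ v))) (norm-scale x p (λ v → F (s+ ∷ v))))
    (sym (*-distribˡ-+ x _ _))

  -- The Newton polygon and a dominant term.

  -- Recursion by two successors, so that `double (suc r)` reduces to the exponent two steps on that
  -- `squeeze` speaks of.
  double : ℕ → ℕ
  double zero    = 0
  double (suc r) = suc (suc (double r))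

  argmax : ∀ e (f : ℕ → ℚ) → Σ ℕ λ j → (j ℕ.< suc e) × (∀ i → i ℕ.< suc e → f i ≤ f j)
  argmax zero    f = 0 , ℕ.s≤s ℕ.z≤n , λ { zero _ → ≤-refl ; (suc i) (ℕ.s≤s ()) }
  argmax (suc e) f with argmax e f
  ... | j , j<e , max with ≤-total (f j) (f (suc e))
  ...   | inj₁ le = suc e , ℕₚ.≤-refl , λ i i<e → bound i (ℕₚ.m≤n⇒m<n∨m≡n (ℕ.s≤s⁻¹ i<e))
    where
    bound : ∀ i → (i ℕ.< suc e) ⊎ (i ≡ suc e) → f i ≤ f (suc e)
    bound i (inj₁ lt)   = ≤-trans (max i lt) le
    bound i (inj₂ refl) = ≤-refl
  ...   | inj₂ ge = j , ℕₚ.m≤n⇒m≤1+n j<e , λ i i<e → bound i (ℕₚ.m≤n⇒m<n∨m≡n (ℕ.s≤s⁻¹ i<e))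
    where
    bound : ∀ i → (i ℕ.< suc e) ⊎ (i ≡ suc e) → f i ≤ f j
    bound i (inj₁ lt)   = max i lt
    bound i (inj₂ refl) = ge

  module Newton (e₀ : ℕ) (M : ℕ → ℚ) (M≥0 : ∀ i → 0ℚ ≤ M i) (β : ℚ) (1≤β : 1ℚ ≤ β) where
    e = suc e₀

    -- t i r = M i · (β^r)^i.  The index of the largest term does not decrease with r; if it is
    -- the same at two consecutive even r, it dominates by the factor β in between.
    t : ℕ → ℕ → ℚ
    t i zero    = M i
    t i (suc r) = β ^^ i * t i r

    0<β : 0ℚ < β
    0<β = <-≤-trans 0<1 1≤β

    0≤β : 0ℚ ≤ β
    0≤β = <⇒≤ 0<β

    t≥0 : ∀ i r → 0ℚ ≤ t i r
    t≥0 i zero    = M≥0 i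
    t≥0 i (suc r) = *-nonneg (^^-nonneg i 0≤β) (t≥0 i r)

    Max : ℕ → ℕ → Set
    Max r j = ∀ i → i ℕ.< e → t i r ≤ t j r

    Dominates : ℕ → ℕ → Set
    Dominates r j = ∀ i → i ℕ.< e → i ≢ j → β * t i r ≤ t j r

    -- The larger index also gains the larger factor, so a comparison in its favour persists as r
    -- grows.
    step-mono : ∀ {i j} r → i ℕ.≤ j → t i r ≤ t j r → β ^^ i * t i r ≤ β ^^ j * t j r
    step-mono {i} {j} r i≤j le = begin
      β ^^ i * t i r  ≤⟨ *-mono (^^-nonneg i 0≤β) le ⟩
      β ^^ i * t j r  ≤⟨ *-monoʳ-≤-nonNeg (t j r) {{ℚ.nonNegative (t≥0 j r)}} (^^-mono 1≤β i≤j) ⟩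
      β ^^ j * t j r  ∎
      where open ≤-Reasoning

    -- An index i < j was at most level with j at r and has since fallen behind by a factor β; an
    -- index i > j is at most level at r + 2 and still has to gain a factor β on the way there.
    squeeze : ∀ r j → Max r j → Max (suc (suc r)) j → Dominates (suc r) j
    squeeze r j lo hi i i<e i≢j with ℕₚ.<-cmp i j
    ... | tri≈ _ i≡j _ = ⊥-elim (i≢j i≡j)
    ... | tri< i<j _ _ = begin
      β * (β ^^ i * t i r)   ≡⟨ *-assoc β (β ^^ i) (t i r) ⟨
      β ^^ suc i * t i r     ≤⟨ *-mono (^^-nonneg (suc i) 0≤β) (lo i i<e) ⟩
      β ^^ suc i * t j r     ≤⟨ *-monoʳ-≤-nonNeg (t j r) {{ℚ.nonNegative (t≥0 j r)}} (^^-mono 1≤β i<j) ⟩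
      β ^^ j * t j r         ∎
      where open ≤-Reasoning
    ... | tri> _ _ j<i = *-cancelˡ-≤-pos (β ^^ j) {{ℚ.positive (^^-pos j 0<β)}} (begin
      β ^^ j * (β * t i (suc r))  ≡⟨ lem (β ^^ j) β (t i (suc r)) ⟩
      β ^^ suc j * t i (suc r)    ≤⟨ *-monoʳ-≤-nonNeg (t i (suc r)) {{ℚ.nonNegative (t≥0 i (suc r))}} (^^-mono 1≤β j<i) ⟩
      β ^^ i * t i (suc r)        ≤⟨ hi i i<e ⟩
      β ^^ j * t j (suc r)        ∎)
      where
      open ≤-Reasoning
      lem : ∀ a b c → a * (b * c) ≡ (b * a) * c
      lem = solve-∀ ℚ-ring

    Dominant : Set
    Dominant = Σ ℕ λ r → Σ ℕ λ j → (r ℕ.< e) × (j ℕ.< e) × Dominates (suc (double r)) j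

    -- Pigeonhole: as long as no index dominates, the largest one grows strictly from each even step
    -- to the next, so it is at least r after r of them. At r = e this leaves the range.
    walk : ∀ r → r ℕ.≤ e → Dominant ⊎ Σ ℕ λ j → (r ℕ.≤ j) × (j ℕ.< e) × Max (double r) j
    walk zero    _   = let j , j<e , max = argmax e₀ (λ i → t i 0) in inj₂ (j , ℕ.z≤n , j<e , max)
    walk (suc r) r<e with walk r (ℕₚ.<⇒≤ r<e)
    ... | inj₁ dom                 = inj₁ dom
    ... | inj₂ (j , r≤j , j<e , lo) with argmax e₀ (λ i → t i (double (suc r)))
    ...   | j′ , j′<e , hi with j ℕ.<? j′
    ...     | yes j<j′ = inj₂ (j′ , ℕₚ.≤-<-trans r≤j j<j′ , j′<e , hi)
    -- The new maximal index is at most `j`, so `j` is still maximal by `step-mono` and `squeeze`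
    -- applies.
    ...     | no  j≮j′ = inj₁ (r , j , r<e , j<e , squeeze (double r) j lo (λ i i<e → ≤-trans (hi i i<e) j′≤j))
      where
      j′≤j : t j′ (double (suc r)) ≤ t j (double (suc r))
      j′≤j = step-mono (suc (double r)) le (step-mono (double r) le (lo j′ j′<e))
        where le = ℕₚ.≮⇒≥ j≮j′

    dominant : Dominant
    dominant with walk e ℕₚ.≤-refl
    ... | inj₁ dom                 = dom
    ... | inj₂ (j , e≤j , j<e , _) = ⊥-elim (ℕₚ.<-irrefl refl (ℕₚ.≤-<-trans e≤j j<e))

    ^^-distrib : ∀ a b i → (a * b) ^^ i ≡ a ^^ i * b ^^ i
    ^^-distrib a b zero    = sym (*-identityˡ 1ℚ)
    ^^-distrib a b (suc i) = trans (cong ((a * b) *_) (^^-distrib a b i)) (lem a b (a ^^ i) (b ^^ i))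
      where
      lem : ∀ a b c d → (a * b) * (c * d) ≡ (a * c) * (b * d)
      lem = solve-∀ ℚ-ring

    1^^ : ∀ i → 1ℚ ^^ i ≡ 1ℚ
    1^^ zero    = refl
    1^^ (suc i) = trans (*-identityˡ _) (1^^ i)

    t≡ : ∀ i r → t i r ≡ M i * (β ^^ r) ^^ i
    t≡ i zero    = sym (trans (cong (M i *_) (1^^ i)) (*-identityʳ (M i)))
    t≡ i (suc r) = trans (cong (β ^^ i *_) (t≡ i r))
      (trans (lem (β ^^ i) (M i) ((β ^^ r) ^^ i)) (cong (M i *_) (sym (^^-distrib β (β ^^ r) i))))
      where
      lem : ∀ a b c → a * (b * c) ≡ b * (a * c)
      lem = solve-∀ ℚ-ring

  -- Finite sums close to a single term.

  sumTo : ℕ → (ℕ → ℚ) → ℚ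
  sumTo zero    f = 0ℚ
  sumTo (suc e) f = sumTo e f + f e

  fromℕ-suc-* : ∀ e T → fromℕ e * T + T ≡ fromℕ (suc e) * T
  fromℕ-suc-* e T = trans (lem (fromℕ e) T) (cong (_* T) (sym (fromℕ-suc e)))
    where
    lem : ∀ x y → x * y + y ≡ (1ℚ + x) * y
    lem = solve-∀ ℚ-ring

  ∣+∣-bound : ∀ {β x y K T} → 0ℚ ≤ β → β * ∣ x ∣ ≤ K → β * ∣ y ∣ ≤ T → β * ∣ x + y ∣ ≤ K + T
  ∣+∣-bound {β} {x} {y} {K} {T} 0≤β p q = begin
    β * ∣ x + y ∣          ≤⟨ *-mono 0≤β (∣p+q∣≤∣p∣+∣q∣ x y) ⟩
    β * (∣ x ∣ + ∣ y ∣)    ≡⟨ *-distribˡ-+ β ∣ x ∣ ∣ y ∣ ⟩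
    β * ∣ x ∣ + β * ∣ y ∣  ≤⟨ +-mono-≤ p q ⟩
    K + T                  ∎
    where open ≤-Reasoning

  sumTo-bound : ∀ e {q β T} → 0ℚ ≤ β → (∀ i → i ℕ.< e → β * ∣ q i ∣ ≤ T) →
                β * ∣ sumTo e q ∣ ≤ fromℕ e * T
  sumTo-bound zero    {β = β} {T} _ h = ≤-reflexive (trans (*-zeroʳ β) (sym (*-zeroˡ T)))
  sumTo-bound (suc e) {q} {β} {T} 0≤β h = subst (β * ∣ sumTo e q + q e ∣ ≤_) (fromℕ-suc-* e T)
    (∣+∣-bound 0≤β (sumTo-bound e 0≤β (λ i i<e → h i (ℕₚ.m≤n⇒m≤1+n i<e))) (h e ℕₚ.≤-refl))

  -- There are e - 1 terms left, each contributing at most T; the bound leaves room for one more.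
  residual-bound : ∀ e {q β T} j → 0ℚ ≤ β → 0ℚ ≤ T → j ℕ.< e →
                   (∀ i → i ℕ.< e → i ≢ j → β * ∣ q i ∣ ≤ T) → β * ∣ sumTo e q - q j ∣ ≤ fromℕ e * T
  residual-bound (suc e) {q} {β} {T} j 0≤β 0≤T j<e h with ℕₚ.m≤n⇒m<n∨m≡n (ℕ.s≤s⁻¹ j<e)
  ... | inj₁ j<e′ = subst₂ _≤_ (cong (λ z → β * ∣ z ∣) (lem (sumTo e q) (q j) (q e))) (fromℕ-suc-* e T)
      (∣+∣-bound {x = sumTo e q - q j} 0≤β
        (residual-bound e j 0≤β 0≤T j<e′ (λ i i<e → h i (ℕₚ.m≤n⇒m≤1+n i<e)))
        (h e ℕₚ.≤-refl (λ e≡j → ℕₚ.<-irrefl (sym e≡j) j<e′)))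
    where
    lem : ∀ a b c → (a - b) + c ≡ (a + c) - b
    lem = solve-∀ ℚ-ring
  ... | inj₂ refl = begin
      β * ∣ (sumTo e q + q e) - q e ∣  ≡⟨ cong (λ z → β * ∣ z ∣) (lem (sumTo e q) (q e)) ⟩
      β * ∣ sumTo e q ∣                ≤⟨ sumTo-bound e 0≤β (λ i i<e → h i (ℕₚ.m≤n⇒m≤1+n i<e) (ℕₚ.<⇒≢ i<e)) ⟩
      fromℕ e * T                      ≡⟨ +-identityʳ _ ⟨
      fromℕ e * T + 0ℚ                 ≤⟨ +-monoʳ-≤ (fromℕ e * T) 0≤T ⟩
      fromℕ e * T + T                  ≡⟨ fromℕ-suc-* e T ⟩
      fromℕ (suc e) * T                ∎
    where
    open ≤-Reasoning
    lem : ∀ a b → (a + b) - b ≡ a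
    lem = solve-∀ ℚ-ring

  p≤∣p∣ : ∀ p → p ≤ ∣ p ∣
  p≤∣p∣ p with ≤-total 0ℚ p
  ... | inj₁ 0≤p = ≤-reflexive (sym (0≤p⇒∣p∣≡p 0≤p))
  ... | inj₂ p≤0 = ≤-trans p≤0 (0≤∣p∣ p)

  -- Whichever sign q has, 0 separates it from x or from x′, so one of these is farther from q than
  -- 0 is.
  sandwich : ∀ {β K x x′} q → 0ℚ < β → 0ℚ < x → x′ < 0ℚ →
             β * ∣ x - q ∣ ≤ K → β * ∣ x′ - q ∣ ≤ K → β * ∣ q ∣ < K
  sandwich {β} {K} {x} {x′} q 0<β 0<x x′<0 b b′ with ∣p∣≡p∨∣p∣≡-p q
  ... | inj₁ eq = <-≤-trans (*-monoʳ-<-pos β {{ℚ.positive 0<β}} (begin-strict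
      ∣ q ∣          ≡⟨ eq ⟩
      q              ≡⟨ +-identityˡ q ⟨
      0ℚ + q         <⟨ +-monoˡ-< q (neg-antimono-< x′<0) ⟩
      - x′ + q       ≡⟨ lem x′ q ⟩
      - (x′ - q)     ≤⟨ p≤∣p∣ (- (x′ - q)) ⟩
      ∣ - (x′ - q) ∣ ≡⟨ ∣-p∣≡∣p∣ (x′ - q) ⟩
      ∣ x′ - q ∣     ∎)) b′
    where
    open ≤-Reasoning
    lem : ∀ x q → - x + q ≡ - (x - q)
    lem = solve-∀ ℚ-ring
  ... | inj₂ eq = <-≤-trans (*-monoʳ-<-pos β {{ℚ.positive 0<β}} (begin-strict
      ∣ q ∣          ≡⟨ eq ⟩
      - q            ≡⟨ +-identityˡ (- q) ⟨
      0ℚ - q         <⟨ +-monoˡ-< (- q) 0<x ⟩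
      x - q          ≤⟨ p≤∣p∣ (x - q) ⟩
      ∣ x - q ∣      ∎)) b
    where open ≤-Reasoning

  -- The parity of j, in the form in which u and -u are compared.
  ^^-neg : ∀ j → (∀ u → (- u) ^^ j ≡ u ^^ j) ⊎ (∀ u → (- u) ^^ j ≡ - (u ^^ j))
  ^^-neg zero    = inj₁ (λ _ → refl)
  ^^-neg (suc j) with ^^-neg j
  ... | inj₁ h = inj₂ (λ u → trans (cong (- u *_) (h u)) (sym (neg-distribˡ-* u (u ^^ j))))
  ... | inj₂ h = inj₁ (λ u → trans (cong (- u *_) (h u)) (lem u (u ^^ j)))
    where
    lem : ∀ a b → - a * - b ≡ a * b
    lem = solve-∀ ℚ-ring

  ∣^^∣ : ∀ {u} j → 0ℚ ≤ u → ∣ (- u) ^^ j ∣ ≡ u ^^ j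
  ∣^^∣ {u} j 0≤u with ^^-neg j
  ... | inj₁ h = trans (cong ∣_∣ (h u)) (0≤p⇒∣p∣≡p (^^-nonneg j 0≤u))
  ... | inj₂ h = trans (cong ∣_∣ (h u)) (trans (∣-p∣≡∣p∣ (u ^^ j)) (0≤p⇒∣p∣≡p (^^-nonneg j 0≤u)))

  -- The centre of the ball in `extrapolate`. In `not-small` it is the point where the strict bound
  -- must fail if `M j` is 0.
  avoiding : ∀ σ m → Σ (Vec Sign m) λ y → occ σ y ≡ 0
  avoiding σ  zero    = [] , refl
  avoiding s- (suc m) = let y , eq = avoiding s- m in s+ ∷ y , eq
  avoiding s+ (suc m) = let y , eq = avoiding s+ m in s- ∷ y , eq

  -- The sign pattern at u and -u is impossible.

  module Contradiction
    {m e₀ : ℕ} (a : ℕ → Vec Sign m → ℚ) (a-deg : ∀ j → DegLt (suc e₀) (a j))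
    (β : ℚ) (1≤β : 1ℚ ≤ β) (β-large : 2ℚ ^^ m * (3ℚ ^^ m * fromℕ (suc e₀)) < β) where

    e : ℕ
    e = suc e₀

    P : Vec Sign m → ℚ → ℚ
    P y c = sumTo e (λ j → a j y * c ^^ j)

    M : ℕ → ℚ
    M j = norm (a j)

    open Newton e₀ M (λ j → norm-nonneg (a j)) β 1≤β hiding (e)

    -- Each term other than the j-th is at most `t i r`, hence at most `t j r` / β by dominance.
    -- Stated for any s whose powers have the right absolute values, which covers both u and -u.
    near-term : ∀ r j → j ℕ.< e → Dominates r j → ∀ y s → (∀ i → ∣ s ^^ i ∣ ≡ (β ^^ r) ^^ i) →
                β * ∣ P y s - a j y * s ^^ j ∣ ≤ fromℕ e * t j r
    near-term r j j<e dom y s abs = residual-bound e {λ i → a i y * s ^^ i} j 0≤β (t≥0 j r) j<e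
      (λ i i<e i≢j → ≤-trans (*-mono 0≤β (begin
        ∣ a i y * s ^^ i ∣        ≡⟨ ∣p*q∣≡∣p∣*∣q∣ (a i y) (s ^^ i) ⟩
        ∣ a i y ∣ * ∣ s ^^ i ∣    ≡⟨ cong (∣ a i y ∣ *_) (abs i) ⟩
        ∣ a i y ∣ * (β ^^ r) ^^ i ≤⟨ *-monoʳ-≤-nonNeg ((β ^^ r) ^^ i)
                                       {{ℚ.nonNegative (^^-nonneg i (^^-nonneg r 0≤β))}} (∣∣≤norm (a i) y) ⟩
        M i * (β ^^ r) ^^ i       ≡⟨ t≡ i r ⟨
        t i r                     ∎)) (dom i i<e i≢j))
      where open ≤-Reasoning

    Small : Sign → ℕ → Set
    Small σ j = ∀ y → occ σ y ℕ.< e → β * ∣ a j y ∣ < fromℕ e * M j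

    -- A coefficient that is small on one side of the cube is, by extrapolation, small everywhere.
    not-small : ∀ σ j → Small σ j → ⊥
    not-small σ j small with M j ≤? 0ℚ
    ... | yes M≤0 = let y , eq = avoiding σ m in <-irrefl refl (begin-strict
        0ℚ                  ≤⟨ *-nonneg 0≤β (0≤∣p∣ (a j y)) ⟩
        β * ∣ a j y ∣       <⟨ small y (subst (ℕ._< e) (sym eq) (ℕ.s≤s ℕ.z≤n)) ⟩
        fromℕ e * M j       ≤⟨ *-mono (fromℤ-≤ {ℤ.+ 0} (ℤ.+≤+ ℕ.z≤n)) M≤0 ⟩
        fromℕ e * 0ℚ        ≡⟨ *-zeroʳ (fromℕ e) ⟩
        0ℚ                  ∎)
      where open ≤-Reasoning
    ... | no M≰0 = <-irrefl refl (begin-strict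
        β * M j                                  ≡⟨ norm-scale β 0≤β (a j) ⟨
        norm (λ y → β * a j y)                   ≤⟨ norm≤ (λ y → β * a j y) everywhere ⟩
        2ℚ ^^ m * (3ℚ ^^ m * (fromℕ e * M j))    ≡⟨ lem (2ℚ ^^ m) (3ℚ ^^ m) (fromℕ e) (M j) ⟩
        (2ℚ ^^ m * (3ℚ ^^ m * fromℕ e)) * M j    <⟨ *-monoˡ-<-pos (M j) {{ℚ.positive (≰⇒> M≰0)}} β-large ⟩
        β * M j                                  ∎)
      where
      open ≤-Reasoning
      lem : ∀ a b c d → a * (b * (c * d)) ≡ (a * (b * c)) * d
      lem = solve-∀ ℚ-ring
      everywhere : ∀ y → ∣ β * a j y ∣ ≤ 3ℚ ^^ m * (fromℕ e * M j)
      everywhere = extrapolate σ e (*-nonneg (fromℤ-≤ {ℤ.+ 0} (ℤ.+≤+ ℕ.z≤n)) (norm-nonneg (a j)))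
        (deg-scale e β (a-deg j))
        (λ y lt → subst (_≤ fromℕ e * M j)
          (sym (trans (∣p*q∣≡∣p∣*∣q∣ β (a j y)) (cong (_* ∣ a j y ∣) (0≤p⇒∣p∣≡p 0≤β)))) (<⇒≤ (small y lt)))

    module Near (r j : ℕ) (j<e : j ℕ.< e) (dom : Dominates (suc (double r)) j) where
      ρ = suc (double r)
      u = β ^^ ρ

      0≤u : 0ℚ ≤ u
      0≤u = ^^-nonneg ρ 0≤β

      near⁺ : ∀ y → β * ∣ P y u - a j y * u ^^ j ∣ ≤ fromℕ e * t j ρ
      near⁺ y = near-term ρ j j<e dom y u (λ i → 0≤p⇒∣p∣≡p (^^-nonneg i 0≤u))

      near⁻ : ∀ y → β * ∣ P y (- u) - a j y * (- u) ^^ j ∣ ≤ fromℕ e * t j ρ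
      near⁻ y = near-term ρ j j<e dom y (- u) (λ i → ∣^^∣ i 0≤u)

      cancel : ∀ y → β * ∣ a j y * u ^^ j ∣ < fromℕ e * t j ρ → β * ∣ a j y ∣ < fromℕ e * M j
      cancel y lt = *-cancelʳ-<-nonNeg (u ^^ j) {{ℚ.nonNegative (^^-nonneg j 0≤u)}}
        (subst₂ _<_
          (trans (cong (β *_) (trans (∣p*q∣≡∣p∣*∣q∣ (a j y) (u ^^ j))
                   (cong (∣ a j y ∣ *_) (0≤p⇒∣p∣≡p (^^-nonneg j 0≤u)))))
                 (sym (*-assoc β ∣ a j y ∣ (u ^^ j))))
          (trans (cong (fromℕ e *_) (t≡ j ρ)) (sym (*-assoc (fromℕ e) (M j) (u ^^ j)))) lt)

    -- At a dominant j, P is close to its j-th term at u and at -u. Where P changes sign an even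
    -- power does not, and where P is positive at both points an odd power does change sign; either
    -- mismatch makes the coefficient small by `sandwich`.
    contradiction :
      (∀ r → r ℕ.< e → ∀ y → occ s- y ℕ.< e →
        (0ℚ < P y (β ^^ suc (double r))) × (0ℚ < P y (- (β ^^ suc (double r))))) →
      (∀ r → r ℕ.< e → ∀ y → occ s+ y ℕ.< e →
        (0ℚ < P y (β ^^ suc (double r))) × (P y (- (β ^^ suc (double r))) < 0ℚ)) → ⊥
    contradiction hyp⁺ hyp⁻ with dominant
    ... | r , j , r<e , j<e , dom with ^^-neg j
    ...   | inj₁ even = not-small s+ j (λ y lt → cancel y (sandwich (a j y * u ^^ j) 0<β
              (proj₁ (hyp⁻ r r<e y lt)) (proj₂ (hyp⁻ r r<e y lt)) (near⁺ y)
              (subst (λ z → β * ∣ P y (- u) - a j y * z ∣ ≤ fromℕ e * t j ρ) (even u) (near⁻ y))))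
      where open Near r j j<e dom
    ...   | inj₂ odd  = not-small s- j (λ y lt → cancel y (sandwich (a j y * u ^^ j) 0<β
              -- The negative value is -P(-u), whose j-th term agrees with that of P(u) because j is
              -- odd.
              (proj₁ (hyp⁺ r r<e y lt)) (neg-antimono-< (proj₂ (hyp⁺ r r<e y lt))) (near⁺ y)
              (subst (λ z → β * z ≤ fromℕ e * t j ρ)
                (trans (cong (λ z → ∣ P y (- u) - a j y * z ∣) (odd u))
                  (trans (cong ∣_∣ (lem (P y (- u)) (a j y) (u ^^ j)))
                    (∣-p∣≡∣p∣ (- P y (- u) - a j y * u ^^ j))))
                (near⁻ y))))
      where
      open Near r j j<e dom
      lem : ∀ p a v → p - a * - v ≡ - (- p - a * v)
      lem = solve-∀ ℚ-ring

  -- Coefficients of the symmetrized polynomial.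

  sumTo-front : ∀ e h → sumTo (suc e) h ≡ h 0 + sumTo e (h ∘ suc)
  sumTo-front zero    h = +-comm 0ℚ (h 0)
  sumTo-front (suc e) h = trans (cong (_+ h (suc e)) (sumTo-front e h)) (+-assoc (h 0) (sumTo e (h ∘ suc)) (h (suc e)))

  sumTo-cong : ∀ e {f g} → (∀ j → f j ≡ g j) → sumTo e f ≡ sumTo e g
  sumTo-cong zero    eq = refl
  sumTo-cong (suc e) eq = cong₂ _+_ (sumTo-cong e eq) (eq e)

  sumTo-scale : ∀ e k f → sumTo e (λ j → k * f j) ≡ k * sumTo e f
  sumTo-scale zero    k f = sym (*-zeroʳ k)
  sumTo-scale (suc e) k f = trans (cong (_+ k * f e) (sumTo-scale e k f)) (sym (*-distribˡ-+ k (sumTo e f) (f e)))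

  sumTo-zero : ∀ e → sumTo e (λ _ → 0ℚ) ≡ 0ℚ
  sumTo-zero zero    = refl
  sumTo-zero (suc e) = trans (+-identityʳ (sumTo e (λ _ → 0ℚ))) (sumTo-zero e)

  sumTo-linear : ∀ e k (α b : ℕ → ℚ) c → k * sumTo e (λ j → α j * c ^^ j) + sumTo e (λ j → b j * c ^^ j)
                 ≡ sumTo e (λ j → (k * α j + b j) * c ^^ j)
  sumTo-linear zero    k α b c = trans (+-identityʳ (k * 0ℚ)) (*-zeroʳ k)
  sumTo-linear (suc e) k α b c = trans
    (lem k (sumTo e (λ j → α j * c ^^ j)) (sumTo e (λ j → b j * c ^^ j)) (α e) (b e) (c ^^ e))
    (cong (_+ (k * α e + b e) * c ^^ e) (sumTo-linear e k α b c))
    where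
    lem : ∀ k x y a b p → k * (x + a * p) + (y + b * p) ≡ (k * x + y) + (k * a + b) * p
    lem = solve-∀ ℚ-ring

  poly-coefficients : ∀ e {f} → PolyLt e f → Σ (ℕ → ℚ) λ α → ∀ c → f c ≡ sumTo e (λ j → α j * c ^^ j)
  poly-coefficients zero    p = (λ _ → 0ℚ) , p
  poly-coefficients (suc e) {f} (a , g , p , s) = α′ , λ c → begin
      f c                                            ≡⟨ s c ⟩
      a + c * g c                                    ≡⟨ cong₂ (λ x y → x + c * y) (sym (*-identityʳ a)) (eq c) ⟩
      a * 1ℚ + c * sumTo e (λ j → α j * c ^^ j)      ≡⟨ cong (a * 1ℚ +_) (sumTo-scale e c (λ j → α j * c ^^ j)) ⟨
      a * 1ℚ + sumTo e (λ j → c * (α j * c ^^ j))    ≡⟨ cong (a * 1ℚ +_) (sumTo-cong e (λ j → lem c (α j) (c ^^ j))) ⟩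
      a * 1ℚ + sumTo e (λ j → α j * (c * c ^^ j))    ≡⟨ sumTo-front e (λ j → α′ j * c ^^ j) ⟨
      sumTo (suc e) (λ j → α′ j * c ^^ j)            ∎
    where
    open ≡-Reasoning
    α : ℕ → ℚ
    α = proj₁ (poly-coefficients e p)
    eq : ∀ c → g c ≡ sumTo e (λ j → α j * c ^^ j)
    eq = proj₂ (poly-coefficients e p)
    α′ : ℕ → ℚ
    α′ zero    = a
    α′ (suc j) = α j
    lem : ∀ c a p → c * (a * p) ≡ a * (c * p)
    lem = solve-∀ ℚ-ring

  poly-mono : ∀ {d e f} → d ℕ.≤ e → PolyLt d f → PolyLt e f
  poly-mono {d} {e} {f} d≤e p = go (ℕₚ.≤⇒≤′ d≤e)
    where
    go : ∀ {e} → d ℕ.≤′ e → PolyLt e f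
    go ℕ.≤′-refl             = p
    go {suc e} (ℕ.≤′-step q) = poly-weaken e (go q)

  module Split {A : Set} {k m : ℕ} (pos : A → Fin k) where
    point : Vec Sign k → Vec Sign m → A ⊎ Fin m → Sign
    point x y (inj₁ a) = lookup x (pos a)
    point x y (inj₂ w) = lookup y w

    monoX : List (A ⊎ Fin m) → Vec Sign k → ℚ
    monoX List.[]            x = 1ℚ
    monoX (inj₁ a List.∷ l)  x = signℚ (lookup x (pos a)) * monoX l x
    monoX (inj₂ w List.∷ l)  x = monoX l x

    monoY : List (A ⊎ Fin m) → Vec Sign m → ℚ
    monoY List.[]            y = 1ℚ
    monoY (inj₁ a List.∷ l)  y = monoY l y
    monoY (inj₂ w List.∷ l)  y = signℚ (lookup y w) * monoY l y

    evalMono-split : ∀ l x y → evalMono (point x y) l ≡ monoY l y * monoX l x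
    evalMono-split List.[]           x y = refl
    evalMono-split (inj₁ a List.∷ l) x y = trans (cong (signℚ (lookup x (pos a)) *_) (evalMono-split l x y))
      (lem (signℚ (lookup x (pos a))) (monoY l y) (monoX l x))
      where
      lem : ∀ s a b → s * (a * b) ≡ a * (s * b)
      lem = solve-∀ ℚ-ring
    evalMono-split (inj₂ w List.∷ l) x y = trans (cong (signℚ (lookup y w) *_) (evalMono-split l x y))
      (sym (*-assoc (signℚ (lookup y w)) (monoY l y) (monoX l x)))

    monoX-deg : ∀ l → DegLt (suc (length l)) (monoX l)
    monoX-deg List.[]           = deg-const 0 1ℚ
    monoX-deg (inj₁ a List.∷ l) = deg-var (suc (length l)) (pos a) (monoX-deg l)
    monoX-deg (inj₂ w List.∷ l) = deg-weaken (suc (length l)) (monoX-deg l)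

    monoY-deg : ∀ l → DegLt (suc (length l)) (monoY l)
    monoY-deg List.[]           = deg-const 0 1ℚ
    monoY-deg (inj₁ a List.∷ l) = deg-weaken (suc (length l)) (monoY-deg l)
    monoY-deg (inj₂ w List.∷ l) = deg-var (suc (length l)) w (monoY-deg l)

    -- For fixed y every monomial is a constant times its x-part, so the total degree bounds the
    -- degree in x.
    eval-deg : ∀ e (p : Poly (A ⊎ Fin m)) → degree p ℕ.< e → ∀ y → DegLt e (λ x → eval p (point x y))
    eval-deg e List.[]              _  y = deg-zero e
    eval-deg e ((κ , l) List.∷ p) d<e y = deg-add e
      {λ x → κ * evalMono (point x y) l} {λ x → eval p (point x y)}
      (deg-cong e {λ x → (κ * monoY l y) * monoX l x}
        (λ x → trans (*-assoc κ (monoY l y) (monoX l x)) (cong (κ *_) (sym (evalMono-split l x y))))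
        (deg-scale e (κ * monoY l y) {monoX l}
          (deg-mono (ℕₚ.≤-<-trans (ℕₚ.m≤m⊔n (length l) (degree p)) d<e) (monoX-deg l))))
      (eval-deg e p (ℕₚ.≤-<-trans (ℕₚ.m≤n⊔m (length l) (degree p)) d<e) y)

    module _ (R : Symmetrization k) (w₀ : ℚ) where
      -- Term by term: κ monoY(y) monoX(x) contributes κ α_j monoY(y) to the j-th coefficient, where
      -- the α_j are the coefficients of the symmetrized `monoX`. So `a j` is a combination of
      -- y-monomials of length below e. The argument 1 · c + w₀ moves the origin in the form of
      -- `poly-affine`.
      expand : ∀ e (p : Poly (A ⊎ Fin m)) → degree p ℕ.< e →
        Σ (ℕ → Vec Sign m → ℚ) λ a → (∀ j → DegLt e (a j)) ×
          (∀ y c → ap R (λ x → eval p (point x y)) (1ℚ * c + w₀) ≡ sumTo e (λ j → a j y * c ^^ j))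
      expand e List.[] _ = (λ _ _ → 0ℚ) , (λ _ → deg-zero e) , λ y c → begin
          ap R (λ _ → 0ℚ) (1ℚ * c + w₀)                ≡⟨ ap-scale R 0ℚ (λ _ → 0ℚ) (1ℚ * c + w₀) ⟩
          0ℚ * ap R (λ _ → 0ℚ) (1ℚ * c + w₀)           ≡⟨ *-zeroˡ (ap R (λ _ → 0ℚ) (1ℚ * c + w₀)) ⟩
          0ℚ                                           ≡⟨ sumTo-zero e ⟨
          sumTo e (λ _ → 0ℚ)                           ≡⟨ sumTo-cong e (λ j → sym (*-zeroˡ (c ^^ j))) ⟩
          sumTo e (λ j → 0ℚ * c ^^ j)                  ∎
        where open ≡-Reasoning
      expand e ((κ , l) List.∷ p) d<e =
        (λ j y → (κ * monoY l y) * α j + b j y) ,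
        (λ j → deg-add e {λ y → (κ * monoY l y) * α j} {b j}
                 (deg-cong e {λ y → (κ * α j) * monoY l y} (λ y → lem κ (α j) (monoY l y))
                   (deg-scale e (κ * α j) {monoY l} (deg-mono l<e (monoY-deg l))))
                 (proj₁ (proj₂ rest) j)) ,
        λ y c → let c′ = 1ℚ * c + w₀ ; k = κ * monoY l y in begin
          ap R (λ x → κ * evalMono (point x y) l + eval p (point x y)) c′
            ≡⟨ ap-add R (λ x → κ * evalMono (point x y) l) (λ x → eval p (point x y)) c′ ⟩
          ap R (λ x → κ * evalMono (point x y) l) c′ + ap R (λ x → eval p (point x y)) c′
            ≡⟨ cong (_+ ap R (λ x → eval p (point x y)) c′) (ap-cong R (term y) c′) ⟩
          ap R (λ x → k * monoX l x) c′ + ap R (λ x → eval p (point x y)) c′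
            ≡⟨ cong₂ _+_ (ap-scale R k (monoX l) c′) (proj₂ (proj₂ rest) y c) ⟩
          k * ap R (monoX l) c′ + sumTo e (λ j → b j y * c ^^ j)
            ≡⟨ cong (λ z → k * z + sumTo e (λ j → b j y * c ^^ j)) (proj₂ coeff c) ⟩
          k * sumTo e (λ j → α j * c ^^ j) + sumTo e (λ j → b j y * c ^^ j)
            ≡⟨ sumTo-linear e k α (λ j → b j y) c ⟩
          sumTo e (λ j → (k * α j + b j y) * c ^^ j) ∎
        where
        open ≡-Reasoning
        l<e : length l ℕ.< e
        l<e = ℕₚ.≤-<-trans (ℕₚ.m≤m⊔n (length l) (degree p)) d<e
        rest = expand e p (ℕₚ.≤-<-trans (ℕₚ.m≤n⊔m (length l) (degree p)) d<e)
        coeff : Σ (ℕ → ℚ) λ α → ∀ c → ap R (monoX l) (1ℚ * c + w₀) ≡ sumTo e (λ j → α j * c ^^ j)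
        coeff = poly-coefficients e (poly-mono {f = λ c → ap R (monoX l) (1ℚ * c + w₀)} l<e
                  (poly-affine (suc (length l)) 1ℚ w₀ {ap R (monoX l)} (ap-deg R (suc (length l)) (monoX-deg l))))
        α = proj₁ coeff
        b = proj₁ rest
        term : ∀ y x → κ * evalMono (point x y) l ≡ (κ * monoY l y) * monoX l x
        term y x = trans (cong (κ *_) (evalMono-split l x y)) (sym (*-assoc κ (monoY l y) (monoX l x)))
        lem : ∀ k a m → (k * a) * m ≡ (k * m) * a
        lem = solve-∀ ℚ-ring

  -- Sums of signs and majority.

  sum-allFin-suc : ∀ {N} (h : Fin (suc N) → ℤ) →
    sumℤ (List.map h (allFin (suc N))) ≡ h Fin.zero ℤ.+ sumℤ (List.map (h ∘ Fin.suc) (allFin N))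
  sum-allFin-suc {N} h = cong (λ l → h Fin.zero ℤ.+ sumℤ l)
    (trans (Listₚ.map-tabulate Fin.suc h) (sym (Listₚ.map-tabulate id (h ∘ Fin.suc))))

  sum-cong : ∀ {N} {h k : Fin N → ℤ} → (∀ i → h i ≡ k i) →
    sumℤ (List.map h (allFin N)) ≡ sumℤ (List.map k (allFin N))
  sum-cong {N} eq = cong sumℤ (Listₚ.map-cong eq (allFin N))

  sum-scale : ∀ {N} c (h : Fin N → ℤ) →
    sumℤ (List.map (λ i → c ℤ.* h i) (allFin N)) ≡ c ℤ.* sumℤ (List.map h (allFin N))
  sum-scale {N} c h = go (allFin N)
    where
    go : ∀ l → sumℤ (List.map (λ i → c ℤ.* h i) l) ≡ c ℤ.* sumℤ (List.map h l)
    go List.[]      = sym (ℤₚ.*-zeroʳ c)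
    go (i List.∷ l) = trans (cong (λ z → c ℤ.* h i ℤ.+ z) (go l)) (sym (ℤₚ.*-distribˡ-+ c (h i) _))

  sum-signs : ∀ {m} (v : Vec Sign m) →
    sumℤ (List.map (λ i → signℤ (lookup v i)) (allFin m)) ≡ ℤ.+ occ s+ v ℤ.- ℤ.+ occ s- v
  sum-signs []      = refl
  sum-signs (s ∷ v) = trans (sum-allFin-suc (λ i → signℤ (lookup (s ∷ v) i)))
    (trans (cong (λ z → signℤ s ℤ.+ z) (sum-signs v)) (lem s (ℤ.+ occ s+ v) (ℤ.+ occ s- v)))
    where
    lem⁻ : ∀ a b → ℤ.-[1+ 0 ] ℤ.+ (a ℤ.- b) ≡ a ℤ.- (ℤ.+ 1 ℤ.+ b)
    lem⁻ = ℤ-Solver.solve-∀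
    lem⁺ : ∀ a b → ℤ.+ 1 ℤ.+ (a ℤ.- b) ≡ (ℤ.+ 1 ℤ.+ a) ℤ.- b
    lem⁺ = ℤ-Solver.solve-∀
    lem : ∀ s a b → signℤ s ℤ.+ (a ℤ.- b) ≡ (ℤ.+ hit s+ s ℤ.+ a) ℤ.- (ℤ.+ hit s- s ℤ.+ b)
    lem s- a b = trans (lem⁻ a b) (cong (ℤ._- (ℤ.+ 1 ℤ.+ b)) (sym (ℤₚ.+-identityˡ a)))
    lem s+ a b = trans (lem⁺ a b) (cong (λ z → (ℤ.+ 1 ℤ.+ a) ℤ.- z) (sym (ℤₚ.+-identityˡ b)))

  occ-total : ∀ {m} (v : Vec Sign m) → occ s+ v ℕ.+ occ s- v ≡ m
  occ-total []       = refl
  occ-total (s- ∷ v) = trans (ℕₚ.+-suc (occ s+ v) (occ s- v)) (cong suc (occ-total v))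
  occ-total (s+ ∷ v) = cong suc (occ-total v)

  sgn-pos : ∀ {z} → ℤ.+ 0 ℤ.< z → sgn z ≡ s+
  sgn-pos {ℤ.+ suc _} _ = refl
  sgn-pos {ℤ.+ zero}  (ℤ.+<+ ())

  sgn-nonpos : ∀ {z} → z ℤ.≤ ℤ.+ 0 → sgn z ≡ s-
  sgn-nonpos {ℤ.+ zero}   _ = refl
  sgn-nonpos {ℤ.+ suc _}  (ℤ.+≤+ ())
  sgn-nonpos {ℤ.-[1+ _ ]} _ = refl

  MAJ-plus : ∀ {m} (y : Vec Sign m) → occ s- y ℕ.< occ s+ y → MAJ m (lookup y) ≡ s+
  MAJ-plus y lt = trans (cong sgn (sum-signs y)) (sgn-pos (subst (ℤ._< ℤ.+ occ s+ y ℤ.- ℤ.+ occ s- y) (ℤₚ.+-inverseʳ (ℤ.+ occ s- y))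
    (ℤₚ.+-monoˡ-< (ℤ.- (ℤ.+ occ s- y)) (ℤ.+<+ lt))))

  MAJ-minus : ∀ {m} (y : Vec Sign m) → occ s+ y ℕ.≤ occ s- y → MAJ m (lookup y) ≡ s-
  MAJ-minus y le = trans (cong sgn (sum-signs y)) (sgn-nonpos (ℤₚ.i≤j⇒i-j≤0 (ℤ.+≤+ le)))

  -- The linear form of f in terms of the weight.

  module Rows (n′ : ℕ) where
    open Weight n′

    cell : ∀ N → Vec Sign (N ℕ.* n) → Fin N → Fin n → ℤ
    cell N x i j = ℤ.+ (2 ℕ.^ suc (toℕ i)) ℤ.* signℤ (lookup x (combine i j))

    -- The number N of rows varies separately from the row length n, for the induction on N.
    rowSum : ∀ N → Vec Sign (N ℕ.* n) → ℤ
    rowSum N x = sumℤ (List.map (λ i → sumℤ (List.map (cell N x i) (allFin n))) (allFin N))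

    rowSum-suc : ∀ N (x : Vec Sign n) (v : Vec Sign (N ℕ.* n)) →
      rowSum (suc N) (x ++ v) ≡ ℤ.+ 2 ℤ.* (ℤ.+ occ s+ x ℤ.- ℤ.+ occ s- x) ℤ.+ ℤ.+ 2 ℤ.* rowSum N v
    rowSum-suc N x v = trans (sum-allFin-suc {N} (λ i → sumℤ (List.map (cell (suc N) (x ++ v) i) (allFin n)))) (cong₂ ℤ._+_
      (trans (sum-scale (ℤ.+ 2) (λ j → signℤ (lookup (x ++ v) (combine {suc N} Fin.zero j))))
        (cong (ℤ.+ 2 ℤ.*_) (trans (sum-cong (λ j → cong signℤ (lookup-++ˡ x v j))) (sum-signs x))))
      (trans (sum-cong {N} (λ i → trans (sum-cong (λ j → step i j)) (sum-scale (ℤ.+ 2) (cell N v i))))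
        (sum-scale {N} (ℤ.+ 2) (λ i → sumℤ (List.map (cell N v i) (allFin n))))))
      where
      step : ∀ i j → cell (suc N) (x ++ v) (Fin.suc i) j ≡ ℤ.+ 2 ℤ.* cell N v i j
      step i j = trans (cong₂ ℤ._*_ (pow-suc (suc (toℕ i))) (cong signℤ (lookup-++ʳ x v (combine i j))))
        (ℤₚ.*-assoc (ℤ.+ 2) (ℤ.+ (2 ℕ.^ suc (toℕ i))) (signℤ (lookup v (combine i j))))

    -- A row with w entries +1 has sign sum 2w - n, and the factors 2^(i+1) for i < N add up to 2
    -- (2^N - 1).
    rowSum-weight : ∀ N x → rowSum N x ≡ ℤ.+ 4 ℤ.* weight N x ℤ.- ℤ.+ 2 ℤ.* (ℤ.+ n ℤ.* (pow N ℤ.- ℤ.+ 1))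
    rowSum-weight zero    [] = sym (cong (λ z → ℤ.+ 0 ℤ.- ℤ.+ 2 ℤ.* z) (ℤₚ.*-zeroʳ (ℤ.+ n)))
    rowSum-weight (suc N) z with splitAt n z
    ... | x , v , refl = begin
      rowSum (suc N) (x ++ v)
        ≡⟨ rowSum-suc N x v ⟩
      ℤ.+ 2 ℤ.* (A ℤ.- B) ℤ.+ ℤ.+ 2 ℤ.* rowSum N v
        ≡⟨ cong (λ z → ℤ.+ 2 ℤ.* (A ℤ.- B) ℤ.+ ℤ.+ 2 ℤ.* z) (rowSum-weight N v) ⟩
      ℤ.+ 2 ℤ.* (A ℤ.- B) ℤ.+ ℤ.+ 2 ℤ.* (ℤ.+ 4 ℤ.* weight N v ℤ.- ℤ.+ 2 ℤ.* (ℤ.+ n ℤ.* (pow N ℤ.- ℤ.+ 1)))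
        ≡⟨ cong (λ z → ℤ.+ 2 ℤ.* (A ℤ.- B) ℤ.+ ℤ.+ 2 ℤ.* (ℤ.+ 4 ℤ.* weight N v ℤ.- ℤ.+ 2 ℤ.* (z ℤ.* (pow N ℤ.- ℤ.+ 1)))) n≡ ⟩
      ℤ.+ 2 ℤ.* (A ℤ.- B) ℤ.+ ℤ.+ 2 ℤ.* (ℤ.+ 4 ℤ.* weight N v ℤ.- ℤ.+ 2 ℤ.* ((A ℤ.+ B) ℤ.* (pow N ℤ.- ℤ.+ 1)))
        ≡⟨ lem A B (weight N v) (pow N) ⟩
      ℤ.+ 4 ℤ.* (A ℤ.+ ℤ.+ 2 ℤ.* weight N v) ℤ.- ℤ.+ 2 ℤ.* ((A ℤ.+ B) ℤ.* (ℤ.+ 2 ℤ.* pow N ℤ.- ℤ.+ 1))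
        ≡⟨ cong₂ (λ a b → a ℤ.- ℤ.+ 2 ℤ.* b) (cong (ℤ.+ 4 ℤ.*_) (sym (rowWeight-++ (weight N) x v)))
             (cong₂ (λ a b → a ℤ.* (b ℤ.- ℤ.+ 1)) (sym n≡) (sym (pow-suc N))) ⟩
      ℤ.+ 4 ℤ.* weight (suc N) (x ++ v) ℤ.- ℤ.+ 2 ℤ.* (ℤ.+ n ℤ.* (pow (suc N) ℤ.- ℤ.+ 1)) ∎
      where
      open ≡-Reasoning
      A = ℤ.+ occ s+ x
      B = ℤ.+ occ s- x
      n≡ : ℤ.+ n ≡ A ℤ.+ B
      n≡ = cong ℤ.+_ (sym (occ-total x))
      lem : ∀ A B w p → ℤ.+ 2 ℤ.* (A ℤ.- B) ℤ.+ ℤ.+ 2 ℤ.* (ℤ.+ 4 ℤ.* w ℤ.- ℤ.+ 2 ℤ.* ((A ℤ.+ B) ℤ.* (p ℤ.- ℤ.+ 1)))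
                      ≡ ℤ.+ 4 ℤ.* (A ℤ.+ ℤ.+ 2 ℤ.* w) ℤ.- ℤ.+ 2 ℤ.* ((A ℤ.+ B) ℤ.* (ℤ.+ 2 ℤ.* p ℤ.- ℤ.+ 1))
      lem = ℤ-Solver.solve-∀

    K : ℤ
    K = ℤ.+ n ℤ.* (pow n ℤ.- ℤ.+ 1)

    -- This is K / 2 rounded up. With W = W₀ + u the argument of the sign becomes 1 + 2δ + 4u, which
    -- for δ = 0 or 1 is positive exactly when u ≥ 0.
    center : Σ ℤ λ W₀ → Σ ℤ λ δ → (ℤ.+ 2 ℤ.* W₀ ≡ K ℤ.+ δ) × (ℤ.+ 0 ℤ.≤ δ) × (δ ℤ.≤ ℤ.+ 1)
    center with parity K
    ... | inj₁ (V , eq) = V , ℤ.+ 0 , trans (sym (ℤₚ.+-identityˡ _)) (trans (sym eq) (sym (ℤₚ.+-identityʳ K))) , ℤ.+≤+ ℕ.z≤n , ℤ.+≤+ ℕ.z≤n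
    ... | inj₂ (V , eq) = V ℤ.+ ℤ.+ 1 , ℤ.+ 1 , trans (lem V) (cong (ℤ._+ ℤ.+ 1) (sym eq)) , ℤ.+≤+ ℕ.z≤n , ℤₚ.≤-refl
      where
      lem : ∀ V → ℤ.+ 2 ℤ.* (V ℤ.+ ℤ.+ 1) ≡ ℤ.+ 1 ℤ.+ ℤ.+ 2 ℤ.* V ℤ.+ ℤ.+ 1
      lem = ℤ-Solver.solve-∀

    W₀ δ : ℤ
    W₀ = proj₁ center
    δ  = proj₁ (proj₂ center)
    2W₀≡ : ℤ.+ 2 ℤ.* W₀ ≡ K ℤ.+ δ
    2W₀≡ = proj₁ (proj₂ (proj₂ center))
    0≤δ : ℤ.+ 0 ℤ.≤ δ
    0≤δ = proj₁ (proj₂ (proj₂ (proj₂ center)))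
    δ≤1 : δ ℤ.≤ ℤ.+ 1
    δ≤1 = proj₂ (proj₂ (proj₂ (proj₂ center)))

    fFun≡ : ∀ x u → weight n x ≡ W₀ ℤ.+ u →
            fFun n (λ ij → lookup x (combine (proj₁ ij) (proj₂ ij))) ≡ sgn (ℤ.+ 1 ℤ.+ ℤ.+ 2 ℤ.* δ ℤ.+ ℤ.+ 4 ℤ.* u)
    fFun≡ x u eq = cong sgn (begin
      ℤ.+ 1 ℤ.+ rowSum n x                                       ≡⟨ cong (λ z → ℤ.+ 1 ℤ.+ z) (rowSum-weight n x) ⟩
      ℤ.+ 1 ℤ.+ (ℤ.+ 4 ℤ.* weight n x ℤ.- ℤ.+ 2 ℤ.* K)           ≡⟨ cong (λ z → ℤ.+ 1 ℤ.+ (ℤ.+ 4 ℤ.* z ℤ.- ℤ.+ 2 ℤ.* K)) eq ⟩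
      ℤ.+ 1 ℤ.+ (ℤ.+ 4 ℤ.* (W₀ ℤ.+ u) ℤ.- ℤ.+ 2 ℤ.* K)           ≡⟨ l₁ W₀ u K ⟩
      ℤ.+ 1 ℤ.+ ℤ.+ 2 ℤ.* (ℤ.+ 2 ℤ.* W₀) ℤ.- ℤ.+ 2 ℤ.* K ℤ.+ ℤ.+ 4 ℤ.* u
        ≡⟨ cong (λ z → ℤ.+ 1 ℤ.+ ℤ.+ 2 ℤ.* z ℤ.- ℤ.+ 2 ℤ.* K ℤ.+ ℤ.+ 4 ℤ.* u) 2W₀≡ ⟩
      ℤ.+ 1 ℤ.+ ℤ.+ 2 ℤ.* (K ℤ.+ δ) ℤ.- ℤ.+ 2 ℤ.* K ℤ.+ ℤ.+ 4 ℤ.* u  ≡⟨ l₂ K δ u ⟩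
      ℤ.+ 1 ℤ.+ ℤ.+ 2 ℤ.* δ ℤ.+ ℤ.+ 4 ℤ.* u                      ∎)
      where
      open ≡-Reasoning
      l₁ : ∀ W u K → ℤ.+ 1 ℤ.+ (ℤ.+ 4 ℤ.* (W ℤ.+ u) ℤ.- ℤ.+ 2 ℤ.* K) ≡ ℤ.+ 1 ℤ.+ ℤ.+ 2 ℤ.* (ℤ.+ 2 ℤ.* W) ℤ.- ℤ.+ 2 ℤ.* K ℤ.+ ℤ.+ 4 ℤ.* u
      l₁ = ℤ-Solver.solve-∀
      l₂ : ∀ K d u → ℤ.+ 1 ℤ.+ ℤ.+ 2 ℤ.* (K ℤ.+ d) ℤ.- ℤ.+ 2 ℤ.* K ℤ.+ ℤ.+ 4 ℤ.* u ≡ ℤ.+ 1 ℤ.+ ℤ.+ 2 ℤ.* d ℤ.+ ℤ.+ 4 ℤ.* u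
      l₂ = ℤ-Solver.solve-∀

    fFun-plus : ∀ x u → weight n x ≡ W₀ ℤ.+ u → ℤ.+ 0 ℤ.≤ u →
                fFun n (λ ij → lookup x (combine (proj₁ ij) (proj₂ ij))) ≡ s+
    fFun-plus x u eq 0≤u = trans (fFun≡ x u eq) (sgn-pos (begin-strict
      ℤ.+ 0                                                  <⟨ ℤ.+<+ (ℕ.s≤s ℕ.z≤n) ⟩
      ℤ.+ 1 ℤ.+ ℤ.+ 2 ℤ.* ℤ.+ 0 ℤ.+ ℤ.+ 4 ℤ.* ℤ.+ 0
        ≤⟨ ℤₚ.+-mono-≤ (ℤₚ.+-monoʳ-≤ (ℤ.+ 1) (ℤₚ.*-monoˡ-≤-nonNeg (ℤ.+ 2) 0≤δ)) (ℤₚ.*-monoˡ-≤-nonNeg (ℤ.+ 4) 0≤u) ⟩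
      ℤ.+ 1 ℤ.+ ℤ.+ 2 ℤ.* δ ℤ.+ ℤ.+ 4 ℤ.* u                  ∎))
      where open ℤₚ.≤-Reasoning

    fFun-minus : ∀ x u → weight n x ≡ W₀ ℤ.+ u → u ℤ.≤ ℤ.-[1+ 0 ] →
                 fFun n (λ ij → lookup x (combine (proj₁ ij) (proj₂ ij))) ≡ s-
    fFun-minus x u eq u≤-1 = trans (fFun≡ x u eq) (sgn-nonpos (begin
      ℤ.+ 1 ℤ.+ ℤ.+ 2 ℤ.* δ ℤ.+ ℤ.+ 4 ℤ.* u
        ≤⟨ ℤₚ.+-mono-≤ (ℤₚ.+-monoʳ-≤ (ℤ.+ 1) (ℤₚ.*-monoˡ-≤-nonNeg (ℤ.+ 2) δ≤1)) (ℤₚ.*-monoˡ-≤-nonNeg (ℤ.+ 4) u≤-1) ⟩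
      ℤ.-[1+ 0 ]                                             ≤⟨ ℤ.-≤+ ⟩
      ℤ.+ 0                                                  ∎))
      where open ℤₚ.≤-Reasoning

    -- As 2 W₀ = n (2p - 1) + δ with p = 2^(n-1), moving by at most p keeps both strict
    -- inequalities; the upper one needs δ < n, whence 2 ≤ n.
    valid-center : 2 ℕ.≤ n → ∀ u → ℤ.- pow n′ ℤ.≤ u → u ℤ.≤ pow n′ → Valid n′ (W₀ ℤ.+ u)
    valid-center 2≤n u lo hi =
      ℤₚ.*-cancelˡ-<-nonNeg (ℤ.+ 2) (begin-strict
        ℤ.+ 2 ℤ.* (ℤ.+ n ℤ.* p)
          ≡⟨ ℤₚ.+-identityʳ _ ⟨
        ℤ.+ 2 ℤ.* (ℤ.+ n ℤ.* p) ℤ.+ ℤ.+ 0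
          <⟨ ℤₚ.+-monoʳ-< (ℤ.+ 2 ℤ.* (ℤ.+ n ℤ.* p)) (ℤ.+<+ {0} {n} (ℕ.s≤s ℕ.z≤n)) ⟩
        ℤ.+ 2 ℤ.* (ℤ.+ n ℤ.* p) ℤ.+ ℤ.+ n
          ≡⟨ l₁ (ℤ.+ n) p ⟩
        (ℤ.+ n ℤ.* (ℤ.+ 2 ℤ.* p ℤ.- ℤ.+ 1) ℤ.+ ℤ.+ 0) ℤ.+ ℤ.+ 2 ℤ.* (ℤ.- p) ℤ.+ ℤ.+ 2 ℤ.* p ℤ.+ ℤ.+ 2 ℤ.* ℤ.+ n
          ≤⟨ ℤₚ.+-monoˡ-≤ (ℤ.+ 2 ℤ.* ℤ.+ n) (ℤₚ.+-monoˡ-≤ (ℤ.+ 2 ℤ.* p)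
               (ℤₚ.+-mono-≤ (ℤₚ.+-monoʳ-≤ (ℤ.+ n ℤ.* (ℤ.+ 2 ℤ.* p ℤ.- ℤ.+ 1)) 0≤δ) (ℤₚ.*-monoˡ-≤-nonNeg (ℤ.+ 2) lo))) ⟩
        (ℤ.+ n ℤ.* (ℤ.+ 2 ℤ.* p ℤ.- ℤ.+ 1) ℤ.+ δ) ℤ.+ ℤ.+ 2 ℤ.* u ℤ.+ ℤ.+ 2 ℤ.* p ℤ.+ ℤ.+ 2 ℤ.* ℤ.+ n
          ≡⟨ cong (λ z → z ℤ.+ ℤ.+ 2 ℤ.* u ℤ.+ ℤ.+ 2 ℤ.* p ℤ.+ ℤ.+ 2 ℤ.* ℤ.+ n) 2W₀′ ⟨
        ℤ.+ 2 ℤ.* W₀ ℤ.+ ℤ.+ 2 ℤ.* u ℤ.+ ℤ.+ 2 ℤ.* p ℤ.+ ℤ.+ 2 ℤ.* ℤ.+ n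
          ≡⟨ l₂ W₀ u p (ℤ.+ n) ⟩
        ℤ.+ 2 ℤ.* (W₀ ℤ.+ u ℤ.+ p ℤ.+ ℤ.+ n) ∎) ,
      ℤₚ.*-cancelˡ-<-nonNeg (ℤ.+ 2) (begin-strict
        ℤ.+ 2 ℤ.* (W₀ ℤ.+ u)
          ≡⟨ ℤₚ.*-distribˡ-+ (ℤ.+ 2) W₀ u ⟩
        ℤ.+ 2 ℤ.* W₀ ℤ.+ ℤ.+ 2 ℤ.* u
          ≡⟨ cong (ℤ._+ ℤ.+ 2 ℤ.* u) 2W₀′ ⟩
        (ℤ.+ n ℤ.* (ℤ.+ 2 ℤ.* p ℤ.- ℤ.+ 1) ℤ.+ δ) ℤ.+ ℤ.+ 2 ℤ.* u
          <⟨ ℤₚ.+-mono-<-≤ (ℤₚ.+-monoʳ-< (ℤ.+ n ℤ.* (ℤ.+ 2 ℤ.* p ℤ.- ℤ.+ 1)) (ℤₚ.≤-<-trans δ≤1 (ℤ.+<+ 2≤n)))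
                           (ℤₚ.*-monoˡ-≤-nonNeg (ℤ.+ 2) hi) ⟩
        (ℤ.+ n ℤ.* (ℤ.+ 2 ℤ.* p ℤ.- ℤ.+ 1) ℤ.+ ℤ.+ n) ℤ.+ ℤ.+ 2 ℤ.* p
          ≡⟨ l₃ (ℤ.+ n) p ⟩
        ℤ.+ 2 ℤ.* ((ℤ.+ 1 ℤ.+ ℤ.+ n) ℤ.* p) ∎)
      where
      open ℤₚ.≤-Reasoning
      p = pow n′
      2W₀′ : ℤ.+ 2 ℤ.* W₀ ≡ ℤ.+ n ℤ.* (ℤ.+ 2 ℤ.* p ℤ.- ℤ.+ 1) ℤ.+ δ
      2W₀′ = trans 2W₀≡ (cong (λ z → ℤ.+ n ℤ.* (z ℤ.- ℤ.+ 1) ℤ.+ δ) (pow-suc n′))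
      l₁ : ∀ n p → ℤ.+ 2 ℤ.* (n ℤ.* p) ℤ.+ n
           ≡ (n ℤ.* (ℤ.+ 2 ℤ.* p ℤ.- ℤ.+ 1) ℤ.+ ℤ.+ 0) ℤ.+ ℤ.+ 2 ℤ.* (ℤ.- p) ℤ.+ ℤ.+ 2 ℤ.* p ℤ.+ ℤ.+ 2 ℤ.* n
      l₁ = ℤ-Solver.solve-∀
      l₂ : ∀ w u p n → ℤ.+ 2 ℤ.* w ℤ.+ ℤ.+ 2 ℤ.* u ℤ.+ ℤ.+ 2 ℤ.* p ℤ.+ ℤ.+ 2 ℤ.* n ≡ ℤ.+ 2 ℤ.* (w ℤ.+ u ℤ.+ p ℤ.+ n)
      l₂ = ℤ-Solver.solve-∀
      l₃ : ∀ n p → (n ℤ.* (ℤ.+ 2 ℤ.* p ℤ.- ℤ.+ 1) ℤ.+ n) ℤ.+ ℤ.+ 2 ℤ.* p ≡ ℤ.+ 2 ℤ.* ((ℤ.+ 1 ℤ.+ n) ℤ.* p)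
      l₃ = ℤ-Solver.solve-∀

  -- Assembly of the lower bound.

  fromℕ-* : ∀ a b → fromℕ (a ℕ.* b) ≡ fromℕ a * fromℕ b
  fromℕ-* a b = trans (cong fromℤ (ℤₚ.pos-* a b)) (fromℤ-* (ℤ.+ a) (ℤ.+ b))

  fromℕ-^ : ∀ b k → fromℕ (b ℕ.^ k) ≡ fromℕ b ^^ k
  fromℕ-^ b zero    = refl
  fromℕ-^ b (suc k) = trans (fromℕ-* b (b ℕ.^ k)) (cong (fromℕ b *_) (fromℕ-^ b k))

  n<2^n : ∀ n → n ℕ.< 2 ℕ.^ n
  n<2^n zero    = ℕ.s≤s ℕ.z≤n
  n<2^n (suc n) = begin
    2 ℕ.+ n                      ≡⟨ ℕₚ.+-comm 1 (suc n) ⟩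
    suc n ℕ.+ 1                  ≤⟨ ℕₚ.+-mono-≤ (n<2^n n) (ℕₚ.≤-trans (ℕₚ.m^n>0 2 n) (ℕₚ.m≤m+n (2 ℕ.^ n) 0)) ⟩
    2 ℕ.^ n ℕ.+ (2 ℕ.^ n ℕ.+ 0)  ∎
    where open ℕₚ.≤-Reasoning

  -- Makes MAJ constant on each of the two balls from which extrapolation starts.
  occ-minority : ∀ {m} e σ τ (y : Vec Sign m) → occ σ y ℕ.+ occ τ y ≡ m → e ℕ.+ e ℕ.≤ m →
                 occ σ y ℕ.< e → occ σ y ℕ.< occ τ y
  occ-minority {m} e σ τ y total 2e≤m lt with occ σ y ℕ.<? occ τ y
  ... | yes σ<τ = σ<τ
  ... | no  σ≮τ = ⊥-elim (ℕₚ.<-irrefl refl (begin-strict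
      m                        ≡⟨ total ⟨
      occ σ y ℕ.+ occ τ y      ≤⟨ ℕₚ.+-monoʳ-≤ (occ σ y) (ℕₚ.≮⇒≥ σ≮τ) ⟩
      occ σ y ℕ.+ occ σ y      <⟨ ℕₚ.+-mono-< lt lt ⟩
      e ℕ.+ e                  ≤⟨ 2e≤m ⟩
      m                        ∎))
    where open ℕₚ.≤-Reasoning

  ∧ₛ-plusʳ : ∀ s → s ∧ₛ s+ ≡ s+
  ∧ₛ-plusʳ s- = refl
  ∧ₛ-plusʳ s+ = refl

  double≡ : ∀ r → double r ≡ r ℕ.+ r
  double≡ zero    = refl
  double≡ (suc r) = cong suc (trans (cong suc (double≡ r)) (sym (ℕₚ.+-suc r r)))

  module Lower (n′ m : ℕ) (p : Poly ((Fin (suc n′) × Fin (suc n′)) ⊎ Fin m))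
    (rep : SignRep (fFun (suc n′) ∧F MAJ m) p) (2≤n : 2 ℕ.≤ suc n′)
    (e≤n : suc (degree p) ℕ.≤ suc n′) (2e≤m : suc (degree p) ℕ.+ suc (degree p) ℕ.≤ m)
    (room : (4 ℕ.* m) ℕ.* (suc (degree p) ℕ.+ suc (degree p)) ℕ.≤ n′) where

    e : ℕ
    e = suc (degree p)

    open Weight n′
    open Rows n′
    open Split {Fin n × Fin n} {n ℕ.* n} {m} (λ ij → combine (proj₁ ij) (proj₂ ij))

    R : Symmetrization (n ℕ.* n)
    R = sym-rows n′

    coefficients = expand R (fromℤ W₀) e p ℕₚ.≤-refl

    a : ℕ → Vec Sign m → ℚ
    a = proj₁ coefficients

    -- The exponent 4m = m + 2m + m pays for the 2^m points, for 3^m ≤ 4^m from extrapolation and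
    -- for e < 2^m.
    B : ℕ
    B = 2 ℕ.^ (4 ℕ.* m)

    B-large : 2 ℕ.^ m ℕ.* (3 ℕ.^ m ℕ.* e) ℕ.< B
    B-large = begin-strict
      2 ℕ.^ m ℕ.* (3 ℕ.^ m ℕ.* e)              <⟨ ℕₚ.*-monoʳ-< (2 ℕ.^ m) {{ℕₚ.m^n≢0 2 m}} (ℕₚ.*-monoʳ-< (3 ℕ.^ m) {{ℕₚ.m^n≢0 3 m}}
                                                    (ℕₚ.≤-<-trans (ℕₚ.≤-trans (ℕₚ.m≤m+n e e) 2e≤m) (n<2^n m))) ⟩
      2 ℕ.^ m ℕ.* (3 ℕ.^ m ℕ.* 2 ℕ.^ m)        ≤⟨ ℕₚ.*-monoʳ-≤ (2 ℕ.^ m) (ℕₚ.*-monoˡ-≤ (2 ℕ.^ m) (ℕₚ.^-monoˡ-≤ m (ℕₚ.n≤1+n 3))) ⟩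
      2 ℕ.^ m ℕ.* (4 ℕ.^ m ℕ.* 2 ℕ.^ m)        ≡⟨ cong (λ z → 2 ℕ.^ m ℕ.* (z ℕ.* 2 ℕ.^ m)) (ℕₚ.^-*-assoc 2 2 m) ⟩
      2 ℕ.^ m ℕ.* (2 ℕ.^ (2 ℕ.* m) ℕ.* 2 ℕ.^ m) ≡⟨ cong (2 ℕ.^ m ℕ.*_) (ℕₚ.^-distribˡ-+-* 2 (2 ℕ.* m) m) ⟨
      2 ℕ.^ m ℕ.* 2 ℕ.^ (2 ℕ.* m ℕ.+ m)        ≡⟨ ℕₚ.^-distribˡ-+-* 2 m (2 ℕ.* m ℕ.+ m) ⟨
      2 ℕ.^ (m ℕ.+ (2 ℕ.* m ℕ.+ m))            ≡⟨ cong (2 ℕ.^_) (lem m) ⟩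
      B                                        ∎
      where
      open ℕₚ.≤-Reasoning
      lem : ∀ m → m ℕ.+ (2 ℕ.* m ℕ.+ m) ≡ 4 ℕ.* m
      lem = ℕ-Solver.solve-∀

    β : ℚ
    β = fromℕ B

    1≤β : 1ℚ ≤ β
    1≤β = fromℤ-≤ {ℤ.+ 1} (ℤ.+≤+ (ℕₚ.m^n>0 2 (4 ℕ.* m)))

    β-large : 2ℚ ^^ m * (3ℚ ^^ m * fromℕ e) < β
    β-large = subst (_< β)
      (trans (fromℕ-* (2 ℕ.^ m) (3 ℕ.^ m ℕ.* e))
        (cong₂ _*_ (fromℕ-^ 2 m) (trans (fromℕ-* (3 ℕ.^ m) e) (cong (_* fromℕ e) (fromℕ-^ 3 m)))))
      (fromℤ-< (ℤ.+<+ B-large))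

    open Contradiction {m} {degree p} a (proj₁ (proj₂ coefficients)) β 1≤β β-large using (P; contradiction)

    -- The function σ p(·, y) is positive at all x of weight W₀ + z, so its symmetrization is
    -- positive there; linearity takes σ out and `expand` turns the rest into P.
    value : ∀ σ y z → ℤ.- pow n′ ℤ.≤ z → z ℤ.≤ pow n′ →
            (∀ x → weight n x ≡ W₀ ℤ.+ z → (fFun n ∧F MAJ m) (point x y) ≡ σ) →
            0ℚ < signℚ σ * P y (fromℤ z)
    value σ y z lo hi h = subst (0ℚ <_)
      (trans (ap-scale R (signℚ σ) F (fromℤ (W₀ ℤ.+ z)))
        (cong (signℚ σ *_) (trans (cong (ap R F) shift) (proj₂ (proj₂ coefficients) y (fromℤ z)))))
      (sym-rows-pos n′ e e≤n (W₀ ℤ.+ z) (valid-center 2≤n z lo hi) (λ x → signℚ σ * F x)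
        (deg-scale e (signℚ σ) {F} (eval-deg e p ℕₚ.≤-refl y))
        (λ x eq → subst (λ s → 0ℚ < signℚ s * F x) (h x eq) (rep (point x y))))
      where
      F : Vec Sign (n ℕ.* n) → ℚ
      F x = eval p (point x y)
      shift : fromℤ (W₀ ℤ.+ z) ≡ 1ℚ * fromℤ z + fromℤ W₀
      shift = trans (fromℤ-+ W₀ z) (trans (+-comm (fromℤ W₀) (fromℤ z)) (cong (_+ fromℤ W₀) (sym (*-identityˡ (fromℤ z)))))

    U : ℕ → ℕ
    U r = B ℕ.^ suc (double r)

    U≡ : ∀ r → β ^^ suc (double r) ≡ fromℤ (ℤ.+ U r)
    U≡ r = sym (fromℕ-^ B (suc (double r)))

    -U≡ : ∀ r → - (β ^^ suc (double r)) ≡ fromℤ (ℤ.- ℤ.+ U r)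
    -U≡ r = trans (cong -_ (U≡ r)) (sym (fromℤ-neg (ℤ.+ U r)))

    -- Since 2r + 1 ≤ 2e for r < e, `room` keeps all points ±B^(2r+1) within the range of
    -- `valid-center`.
    U≤ : ∀ r → r ℕ.< e → ℤ.+ U r ℤ.≤ pow n′
    U≤ r r<e = ℤ.+≤+ (begin
      B ℕ.^ suc (double r)                    ≡⟨ ℕₚ.^-*-assoc 2 (4 ℕ.* m) (suc (double r)) ⟩
      2 ℕ.^ ((4 ℕ.* m) ℕ.* suc (double r))    ≤⟨ ℕₚ.^-monoʳ-≤ 2 (ℕₚ.≤-trans (ℕₚ.*-monoʳ-≤ (4 ℕ.* m) 2r+1≤2e) room) ⟩
      2 ℕ.^ n′                                ∎)
      where
      open ℕₚ.≤-Reasoning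
      2r+1≤2e : suc (double r) ℕ.≤ e ℕ.+ e
      2r+1≤2e = subst (ℕ._≤ e ℕ.+ e) (cong suc (sym (double≡ r))) (ℕₚ.+-mono-≤ r<e (ℕₚ.<⇒≤ r<e))

    U>0 : ∀ r → 1 ℕ.≤ U r
    U>0 r = ℕₚ.m^n>0 B {{ℕₚ.m^n≢0 2 (4 ℕ.* m)}} (suc (double r))

    lo⁺ : ∀ r → ℤ.- pow n′ ℤ.≤ ℤ.+ U r
    lo⁺ r = ℤₚ.≤-trans (ℤₚ.neg-mono-≤ (ℤ.+≤+ {0} ℕ.z≤n)) (ℤ.+≤+ {0} ℕ.z≤n)

    hi⁻ : ∀ r → ℤ.- ℤ.+ U r ℤ.≤ pow n′
    hi⁻ r = ℤₚ.≤-trans (ℤₚ.neg-mono-≤ (ℤ.+≤+ {0} ℕ.z≤n)) (ℤ.+≤+ {0} ℕ.z≤n)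

    plus : ∀ {x} → 0ℚ < signℚ s+ * x → 0ℚ < x
    plus {x} = subst (0ℚ <_) (*-identityˡ x)

    minus : ∀ {x} → 0ℚ < signℚ s- * x → x < 0ℚ
    minus {x} lt = subst (_< 0ℚ) (lem x) (neg-antimono-< lt)
      where
      lem : ∀ x → - (- 1ℚ * x) ≡ x
      lem = solve-∀ ℚ-ring

    absurd : ⊥
    absurd = contradiction
      -- Few true votes: MAJ(y) is false, and so is f ∧ g whatever x is.
      (λ r r<e y lt →
        let maj : ∀ s → s ∧ₛ MAJ m (lookup y) ≡ s+
            maj s = trans (cong (s ∧ₛ_) (MAJ-plus y (occ-minority e s- s+ y
                      (trans (ℕₚ.+-comm (occ s- y) (occ s+ y)) (occ-total y)) 2e≤m lt))) (∧ₛ-plusʳ s)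
        in subst (λ c → 0ℚ < P y c) (sym (U≡ r))
             (plus (value s+ y (ℤ.+ U r) (lo⁺ r) (U≤ r r<e) (λ x _ → maj _))) ,
           subst (λ c → 0ℚ < P y c) (sym (-U≡ r))
             (plus (value s+ y (ℤ.- ℤ.+ U r) (ℤₚ.neg-mono-≤ (U≤ r r<e)) (hi⁻ r) (λ x _ → maj _))))
      -- Few false votes: MAJ(y) is true and f decides; it is false at u and true at -u ≤ -1.
      (λ r r<e y lt →
        let maj : MAJ m (lookup y) ≡ s-
            maj = MAJ-minus y (ℕₚ.<⇒≤ (occ-minority e s+ s- y (occ-total y) 2e≤m lt))
        in subst (λ c → 0ℚ < P y c) (sym (U≡ r))
             (plus (value s+ y (ℤ.+ U r) (lo⁺ r) (U≤ r r<e)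
               (λ x eq → cong (_∧ₛ MAJ m (lookup y)) (fFun-plus x (ℤ.+ U r) eq (ℤ.+≤+ ℕ.z≤n))))) ,
           subst (λ c → P y c < 0ℚ) (sym (-U≡ r))
             (minus (value s- y (ℤ.- ℤ.+ U r) (ℤₚ.neg-mono-≤ (U≤ r r<e)) (hi⁻ r)
               (λ x eq → cong₂ _∧ₛ_ (fFun-minus x (ℤ.- ℤ.+ U r) eq (ℤₚ.neg-mono-≤ (ℤ.+≤+ (U>0 r)))) maj))))

  -- The rounded-up square root.

  -- Loop invariant: the previous candidate, if any, was too small. With the exit test it pins down
  -- the least k with n ≤ k².
  Low : ℕ → ℕ → Set
  Low n k = (k ≡ 0) ⊎ Σ ℕ λ j → (k ≡ suc j) × (j ℕ.* j ℕ.< n)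

  csqrtAux-spec : ∀ n fuel k → Low n k → n ℕ.≤ (k ℕ.+ fuel) ℕ.* (k ℕ.+ fuel) →
                  Low n (csqrtAux n fuel k) × (n ℕ.≤ csqrtAux n fuel k ℕ.* csqrtAux n fuel k)
  csqrtAux-spec n zero       k low hi = low , subst (λ j → n ℕ.≤ j ℕ.* j) (ℕₚ.+-identityʳ k) hi
  csqrtAux-spec n (suc fuel) k low hi with n ℕ.≤? k ℕ.* k
  ... | yes n≤k² = low , n≤k²
  ... | no  n≰k² = csqrtAux-spec n fuel (suc k) (inj₂ (k , refl , ℕₚ.≰⇒> n≰k²))
                     (subst (λ j → n ℕ.≤ j ℕ.* j) (ℕₚ.+-suc k fuel) hi)

  ceilSqrt-spec : ∀ n → 1 ℕ.≤ n → Σ ℕ λ r → (ceilSqrt n ≡ suc r) × (r ℕ.* r ℕ.< n) × (n ℕ.≤ suc r ℕ.* suc r)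
  ceilSqrt-spec n 1≤n with csqrtAux-spec n (suc n) 0 (inj₁ refl)
                             -- The fuel n + 1 suffices because n ≤ (n + 1)².
                             (ℕₚ.≤-trans (ℕₚ.n≤1+n n) (ℕₚ.m≤m*n (suc n) (suc n)))
  ... | inj₁ eq           , hi = ⊥-elim (ℕₚ.<⇒≱ 1≤n (subst (λ j → n ℕ.≤ j ℕ.* j) eq hi))
  ... | inj₂ (r , eq , lo) , hi = r , eq , lo , subst (λ j → n ℕ.≤ j ℕ.* j) eq hi

  -- The polynomial of the upper bound.

  module Upper {V : Set} where
    mulVar : V → Poly V → Poly V
    mulVar v = List.map (λ t → proj₁ t , v List.∷ proj₂ t)

    eval-mulVar : ∀ v (p : Poly V) z → eval (mulVar v p) z ≡ signℚ (z v) * eval p z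
    eval-mulVar v List.[]            z = sym (*-zeroʳ (signℚ (z v)))
    eval-mulVar v ((κ , l) List.∷ p) z = trans
      (cong (λ x → κ * (signℚ (z v) * evalMono z l) + x) (eval-mulVar v p z))
      (lem κ (signℚ (z v)) (evalMono z l) (eval p z))
      where
      lem : ∀ k s a b → k * (s * a) + s * b ≡ s * (k * a + b)
      lem = solve-∀ ℚ-ring

    eval-++ : ∀ (p q : Poly V) z → eval (p List.++ q) z ≡ eval p z + eval q z
    eval-++ List.[]            q z = sym (+-identityˡ (eval q z))
    eval-++ ((κ , l) List.∷ p) q z = trans (cong (λ x → κ * evalMono z l + x) (eval-++ p q z))
      (sym (+-assoc (κ * evalMono z l) (eval p z) (eval q z)))

    degree-mulVar : ∀ v (p : Poly V) {d} → degree p ℕ.≤ d → degree (mulVar v p) ℕ.≤ suc d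
    degree-mulVar v List.[]            h = ℕ.z≤n
    degree-mulVar v ((κ , l) List.∷ p) h = ℕₚ.⊔-lub (ℕ.s≤s (ℕₚ.m⊔n≤o⇒m≤o (length l) (degree p) h))
      (degree-mulVar v p (ℕₚ.m⊔n≤o⇒n≤o (length l) (degree p) h))

    degree-++ : ∀ (p q : Poly V) {d} → degree p ℕ.≤ d → degree q ℕ.≤ d → degree (p List.++ q) ℕ.≤ d
    degree-++ List.[]            q h k = k
    degree-++ ((κ , l) List.∷ p) q h k = ℕₚ.⊔-lub (ℕₚ.m⊔n≤o⇒m≤o (length l) (degree p) h)
      (degree-++ p q (ℕₚ.m⊔n≤o⇒n≤o (length l) (degree p) h) k)

    -- Multilinear interpolation: the half-sum and the half-difference of the two restrictions are
    -- the even and the odd part of F in the first variable.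
    interp : ∀ {k} → (Vec Sign k → ℚ) → Vec V k → Poly V
    interp F []       = (F [] , List.[]) List.∷ List.[]
    interp F (v ∷ vs) = interp (λ w → ½ * (F (s- ∷ w) + F (s+ ∷ w))) vs
                        List.++ mulVar v (interp (λ w → ½ * (F (s+ ∷ w) - F (s- ∷ w))) vs)

    eval-interp : ∀ {k} F (vs : Vec V k) z → eval (interp F vs) z ≡ F (Vec.map z vs)
    eval-interp F []       z = trans (+-identityʳ (F [] * 1ℚ)) (*-identityʳ (F []))
    eval-interp F (v ∷ vs) z = begin
      eval (interp E vs List.++ mulVar v (interp O vs)) z
        ≡⟨ eval-++ (interp E vs) (mulVar v (interp O vs)) z ⟩
      eval (interp E vs) z + eval (mulVar v (interp O vs)) z
        ≡⟨ cong₂ _+_ (eval-interp E vs z)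
             (trans (eval-mulVar v (interp O vs) z) (cong (signℚ (z v) *_) (eval-interp O vs z))) ⟩
      E w + signℚ (z v) * O w
        ≡⟨ pick (z v) ⟩
      F (z v ∷ w) ∎
      where
      open ≡-Reasoning
      w = Vec.map z vs
      E O : Vec Sign _ → ℚ
      E w = ½ * (F (s- ∷ w) + F (s+ ∷ w))
      O w = ½ * (F (s+ ∷ w) - F (s- ∷ w))
      lem⁻ : ∀ a b → ½ * (a + b) + - 1ℚ * (½ * (b - a)) ≡ a
      lem⁻ = solve-∀ ℚ-ring
      lem⁺ : ∀ a b → ½ * (a + b) + 1ℚ * (½ * (b - a)) ≡ b
      lem⁺ = solve-∀ ℚ-ring
      pick : ∀ s → E w + signℚ s * O w ≡ F (s ∷ w)
      pick s- = lem⁻ (F (s- ∷ w)) (F (s+ ∷ w))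
      pick s+ = lem⁺ (F (s- ∷ w)) (F (s+ ∷ w))

    degree-interp : ∀ {k} F (vs : Vec V k) → degree (interp F vs) ℕ.≤ k
    degree-interp F []               = ℕ.z≤n
    degree-interp {suc k} F (v ∷ vs) = degree-++ (interp E vs) (mulVar v (interp O vs))
      (ℕₚ.m≤n⇒m≤1+n (degree-interp E vs)) (degree-mulVar v (interp O vs) (degree-interp O vs))
      where
      E O : Vec Sign k → ℚ
      E w = ½ * (F (s- ∷ w) + F (s+ ∷ w))
      O w = ½ * (F (s+ ∷ w) - F (s- ∷ w))

    -- The common factor g will be the indicator of MAJ, which every term but the constant one
    -- contains.
    eval-concatMap : ∀ {A : Set} (h : A → Poly V) (k : A → ℤ) g z → (∀ i → eval (h i) z ≡ fromℤ (k i) * g) →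
                     ∀ l → eval (List.concatMap h l) z ≡ fromℤ (sumℤ (List.map k l)) * g
    eval-concatMap h k g z eq List.[]      = sym (*-zeroˡ g)
    eval-concatMap h k g z eq (i List.∷ l) = begin
      eval (h i List.++ List.concatMap h l) z
        ≡⟨ eval-++ (h i) (List.concatMap h l) z ⟩
      eval (h i) z + eval (List.concatMap h l) z
        ≡⟨ cong₂ _+_ (eq i) (eval-concatMap h k g z eq l) ⟩
      fromℤ (k i) * g + fromℤ (sumℤ (List.map k l)) * g
        ≡⟨ *-distribʳ-+ g (fromℤ (k i)) (fromℤ (sumℤ (List.map k l))) ⟨
      (fromℤ (k i) + fromℤ (sumℤ (List.map k l))) * g
        ≡⟨ cong (_* g) (fromℤ-+ (k i) (sumℤ (List.map k l))) ⟨
      fromℤ (k i ℤ.+ sumℤ (List.map k l)) * g ∎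
      where open ≡-Reasoning

    degree-concatMap : ∀ {A : Set} (h : A → Poly V) {d} → (∀ i → degree (h i) ℕ.≤ d) →
                       ∀ l → degree (List.concatMap h l) ℕ.≤ d
    degree-concatMap h le List.[]      = ℕ.z≤n
    degree-concatMap h le (i List.∷ l) = degree-++ (h i) (List.concatMap h l) (le i) (degree-concatMap h le l)

  open Upper

  signℚ≡ : ∀ s → signℚ s ≡ fromℤ (signℤ s)
  signℚ≡ s- = refl
  signℚ≡ s+ = refl

  odd≢0 : ∀ X → ℤ.+ 1 ℤ.+ ℤ.+ 2 ℤ.* X ≢ ℤ.+ 0
  odd≢0 X eq = 1≢2k ℤ.∣ X ∣ (trans (cong ℤ.∣_∣ (sym 2X≡)) (ℤₚ.abs-* (ℤ.+ 2) X))
    where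
    lem : ∀ Y → Y ≡ (ℤ.+ 1 ℤ.+ Y) ℤ.- ℤ.+ 1
    lem = ℤ-Solver.solve-∀
    2X≡ : ℤ.+ 2 ℤ.* X ≡ ℤ.-[1+ 0 ]
    2X≡ = trans (lem (ℤ.+ 2 ℤ.* X)) (cong (ℤ._- ℤ.+ 1) eq)
    1≢2k : ∀ k → 1 ≢ 2 ℕ.* k
    1≢2k (suc k) h with trans (ℕₚ.suc-injective h) (ℕₚ.+-suc k (k ℕ.+ 0))
    ... | ()

  sgn-correct : ∀ L → L ≢ ℤ.+ 0 → 0ℚ < signℚ (sgn L) * fromℤ L
  sgn-correct (ℤ.+ zero)    L≢0 = ⊥-elim (L≢0 refl)
  sgn-correct (ℤ.+ suc k)   _   = subst (0ℚ <_) (sym (*-identityˡ (fromℤ (ℤ.+ suc k)))) (fromℤ-< {ℤ.+ 0} (ℤ.+<+ (ℕ.s≤s ℕ.z≤n)))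
  sgn-correct ℤ.-[1+ k ]    _   = subst (0ℚ <_) (lem (fromℤ ℤ.-[1+ k ])) (neg-antimono-< (fromℤ-< {ℤ.-[1+ k ]} {ℤ.+ 0} ℤ.-<+))
    where
    lem : ∀ x → - x ≡ - 1ℚ * x
    lem = solve-∀ ℚ-ring

  module UpperBound (n m : ℕ) where
    V = (Fin n × Fin n) ⊎ Fin m

    indicator : Sign → ℚ
    indicator s- = 1ℚ
    indicator s+ = 0ℚ

    ys : Vec V m
    ys = Vec.tabulate inj₂

    c : Fin n → ℤ
    c i = ℤ.+ (2 ℕ.^ suc (toℕ i))

    G : Fin n → Vec Sign m → ℚ
    G i y = fromℤ (c i) * indicator (MAJ m (lookup y))

    term : Fin n → Fin n → Poly V
    term i j = mulVar (inj₁ (i , j)) (interp (G i) ys)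

    rep : Poly V
    rep = (1ℚ , List.[]) List.∷ List.concatMap (λ i → List.concatMap (term i) (allFin n)) (allFin n)

    degree-rep : degree rep ℕ.≤ suc m
    degree-rep = degree-concatMap _ (λ i → degree-concatMap (term i)
      (λ j → degree-mulVar (inj₁ (i , j)) (interp (G i) ys) (degree-interp (G i) ys)) (allFin n)) (allFin n)

    module _ (z : V → Sign) where
      maj = MAJ m (λ w → z (inj₂ w))
      g = indicator maj

      D : ℤ
      D = sumℤ (List.map (λ i → sumℤ (List.map (λ j → c i ℤ.* signℤ (z (inj₁ (i , j)))) (allFin n))) (allFin n))

      maj≡ : MAJ m (lookup (Vec.map z ys)) ≡ maj
      maj≡ = cong sgn (sum-cong (λ i → cong signℤ
        (trans (lookup-map i z ys) (cong z (lookup∘tabulate inj₂ i)))))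

      eval-term : ∀ i j → eval (term i j) z ≡ fromℤ (c i ℤ.* signℤ (z (inj₁ (i , j)))) * g
      eval-term i j = begin
        eval (term i j) z
          ≡⟨ eval-mulVar (inj₁ (i , j)) (interp (G i) ys) z ⟩
        signℚ s * eval (interp (G i) ys) z
          ≡⟨ cong₂ _*_ (signℚ≡ s) (eval-interp (G i) ys z) ⟩
        fromℤ (signℤ s) * (fromℤ (c i) * indicator (MAJ m (lookup (Vec.map z ys))))
          ≡⟨ cong (λ t → fromℤ (signℤ s) * (fromℤ (c i) * indicator t)) maj≡ ⟩
        fromℤ (signℤ s) * (fromℤ (c i) * g)
          ≡⟨ lem (fromℤ (signℤ s)) (fromℤ (c i)) g ⟩
        (fromℤ (c i) * fromℤ (signℤ s)) * g
          ≡⟨ cong (_* g) (fromℤ-* (c i) (signℤ s)) ⟨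
        fromℤ (c i ℤ.* signℤ s) * g ∎
        where
        open ≡-Reasoning
        s = z (inj₁ (i , j))
        lem : ∀ a b c → a * (b * c) ≡ (b * a) * c
        lem = solve-∀ ℚ-ring

      eval-rep : eval rep z ≡ 1ℚ + fromℤ D * g
      eval-rep = cong₂ _+_ (*-identityˡ 1ℚ) (eval-concatMap (λ i → List.concatMap (term i) (allFin n)) _ g z
        (λ i → eval-concatMap (term i) _ g z (eval-term i) (allFin n)) (allFin n))

      -- All weights 2^(i+1) are even, so 1 + D is odd; a sign-representing polynomial must not
      -- vanish.
      D-even : Σ ℤ λ X → D ≡ ℤ.+ 2 ℤ.* X
      D-even = _ , trans (sum-cong {n} (λ i → trans (sum-cong {n} (λ j → trans
          (cong (ℤ._* signℤ (z (inj₁ (i , j)))) (ℤₚ.pos-* 2 (2 ℕ.^ toℕ i)))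
          (ℤₚ.*-assoc (ℤ.+ 2) (ℤ.+ (2 ℕ.^ toℕ i)) (signℤ (z (inj₁ (i , j)))))))
          (sum-scale {n} (ℤ.+ 2) (λ j → ℤ.+ (2 ℕ.^ toℕ i) ℤ.* signℤ (z (inj₁ (i , j)))))))
        (sum-scale {n} (ℤ.+ 2) (λ i → sumℤ (List.map (λ j → ℤ.+ (2 ℕ.^ toℕ i) ℤ.* signℤ (z (inj₁ (i , j)))) (allFin n))))

      D≢ : ℤ.+ 1 ℤ.+ D ≢ ℤ.+ 0
      D≢ eq = odd≢0 (proj₁ D-even) (trans (cong (λ w → ℤ.+ 1 ℤ.+ w) (sym (proj₂ D-even))) eq)

      correct : ∀ t → 0ℚ < signℚ (sgn (ℤ.+ 1 ℤ.+ D) ∧ₛ t) * (1ℚ + fromℤ D * indicator t)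
      correct s- = subst₂ (λ s x → 0ℚ < signℚ s * x) (sym (∧ₛ-minusʳ (sgn (ℤ.+ 1 ℤ.+ D))))
        (trans (fromℤ-+ (ℤ.+ 1) D) (cong (1ℚ +_) (sym (*-identityʳ (fromℤ D)))))
        (sgn-correct (ℤ.+ 1 ℤ.+ D) D≢)
        where
        ∧ₛ-minusʳ : ∀ s → s ∧ₛ s- ≡ s
        ∧ₛ-minusʳ s- = refl
        ∧ₛ-minusʳ s+ = refl
      correct s+ = subst₂ (λ s x → 0ℚ < signℚ s * x) (sym (∧ₛ-plusʳ (sgn (ℤ.+ 1 ℤ.+ D))))
        (cong (1ℚ +_) (sym (*-zeroʳ (fromℤ D)))) (*-pos 0<1 0<1)

    sign-rep : SignRep (fFun n ∧F MAJ m) rep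
    sign-rep z = subst (λ x → 0ℚ < signℚ ((fFun n ∧F MAJ m) z) * x) (sym (eval-rep z)) (correct z (maj z))

  -- Numerical inequalities for m = ⌈√n⌉.

  sq-cancel-≤ : ∀ {a b} → a ℕ.* a ℕ.≤ b ℕ.* b → a ℕ.≤ b
  sq-cancel-≤ {a} {b} h with a ℕ.≤? b
  ... | yes a≤b = a≤b
  ... | no  a≰b = ⊥-elim (ℕₚ.<⇒≱ (ℕₚ.*-mono-< (ℕₚ.≰⇒> a≰b) (ℕₚ.≰⇒> a≰b)) h)

  module Arithmetic (n′ d r : ℕ) (400≤n : 400 ℕ.≤ suc n′)
    (r²<n : r ℕ.* r ℕ.< suc n′) (n≤m² : suc n′ ℕ.≤ suc r ℕ.* suc r) where

    n m : ℕ
    n = suc n′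
    m = suc r

    open ℕₚ.≤-Reasoning

    r≤n : r ℕ.≤ n
    r≤n = ℕₚ.≤-trans (r≤r² r) (ℕₚ.<⇒≤ r²<n)
      where
      r≤r² : ∀ r → r ℕ.≤ r ℕ.* r
      r≤r² zero    = ℕ.z≤n
      r≤r² (suc r) = ℕₚ.m≤m*n (suc r) (suc r)

    -- The degree of the representing polynomial is at most m + 1; the estimate expands (r + 2)² and
    -- uses r² < n and r ≤ n.
    [m+1]²≤9n : suc m ℕ.* suc m ℕ.≤ 9 ℕ.* n
    [m+1]²≤9n = begin
      suc m ℕ.* suc m                       ≡⟨ lem r ⟩
      r ℕ.* r ℕ.+ 4 ℕ.* r ℕ.+ 4             ≤⟨ ℕₚ.+-mono-≤ (ℕₚ.+-mono-≤ (ℕₚ.<⇒≤ r²<n) (ℕₚ.*-monoʳ-≤ 4 r≤n)) (ℕₚ.≤-trans (ℕₚ.m≤m+n 4 396) (ℕₚ.≤-trans 400≤n (ℕₚ.m≤m+n n (3 ℕ.* n)))) ⟩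
      n ℕ.+ 4 ℕ.* n ℕ.+ 4 ℕ.* n             ≡⟨ lem′ n ⟩
      9 ℕ.* n                               ∎
      where
      lem : ∀ r → suc (suc r) ℕ.* suc (suc r) ≡ r ℕ.* r ℕ.+ 4 ℕ.* r ℕ.+ 4
      lem = ℕ-Solver.solve-∀
      lem′ : ∀ n → n ℕ.+ 4 ℕ.* n ℕ.+ 4 ℕ.* n ≡ 9 ℕ.* n
      lem′ = ℕ-Solver.solve-∀

    m²≤4n : m ℕ.* m ℕ.≤ 4 ℕ.* n
    m²≤4n = begin
      m ℕ.* m                               ≡⟨ lem r ⟩
      suc (r ℕ.* r) ℕ.+ 2 ℕ.* r             ≤⟨ ℕₚ.+-mono-≤ r²<n (ℕₚ.*-monoʳ-≤ 2 r≤n) ⟩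
      3 ℕ.* n                               ≤⟨ ℕₚ.*-monoˡ-≤ n (ℕₚ.n≤1+n 3) ⟩
      4 ℕ.* n                               ∎
      where
      lem : ∀ r → suc r ℕ.* suc r ≡ suc (r ℕ.* r) ℕ.+ 2 ℕ.* r
      lem = ℕ-Solver.solve-∀

    20≤m : 20 ℕ.≤ m
    20≤m = sq-cancel-≤ (ℕₚ.≤-trans 400≤n n≤m²)

    module _ (small : 1024 ℕ.* (d ℕ.* d) ℕ.< n) where
      32d≤m : 32 ℕ.* d ℕ.≤ m
      32d≤m = sq-cancel-≤ (begin
        (32 ℕ.* d) ℕ.* (32 ℕ.* d)   ≡⟨ lem d ⟩
        1024 ℕ.* (d ℕ.* d)          ≤⟨ ℕₚ.<⇒≤ small ⟩
        n                           ≤⟨ n≤m² ⟩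
        m ℕ.* m                     ∎)
        where
        lem : ∀ d → (32 ℕ.* d) ℕ.* (32 ℕ.* d) ≡ 1024 ℕ.* (d ℕ.* d)
        lem = ℕ-Solver.solve-∀

      2e≤m : suc d ℕ.+ suc d ℕ.≤ m
      2e≤m = ℕₚ.*-cancelˡ-≤ 2 (begin
        2 ℕ.* (suc d ℕ.+ suc d)     ≡⟨ lem d ⟩
        4 ℕ.* d ℕ.+ 4               ≤⟨ ℕₚ.+-mono-≤ (ℕₚ.≤-trans (ℕₚ.*-monoˡ-≤ d (ℕₚ.m≤m+n 4 28)) 32d≤m) (ℕₚ.≤-trans (ℕₚ.m≤m+n 4 16) 20≤m) ⟩
        m ℕ.+ m                     ≡⟨ cong (m ℕ.+_) (ℕₚ.+-identityʳ m) ⟨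
        2 ℕ.* m                     ∎)
        where
        lem : ∀ d → 2 ℕ.* (suc d ℕ.+ suc d) ≡ 4 ℕ.* d ℕ.+ 4
        lem = ℕ-Solver.solve-∀

      -- Four times the square of the left side is m² · 1024 d², where m² ≤ 4n and 1024 d² < n.
      16md≤n : 16 ℕ.* (m ℕ.* d) ℕ.≤ n
      16md≤n = sq-cancel-≤ (ℕₚ.*-cancelˡ-≤ 4 (begin
        4 ℕ.* (16 ℕ.* (m ℕ.* d) ℕ.* (16 ℕ.* (m ℕ.* d)))  ≡⟨ lem m d ⟩
        (m ℕ.* m) ℕ.* (1024 ℕ.* (d ℕ.* d))               ≤⟨ ℕₚ.*-mono-≤ m²≤4n (ℕₚ.<⇒≤ small) ⟩
        (4 ℕ.* n) ℕ.* n                                  ≡⟨ ℕₚ.*-assoc 4 n n ⟩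
        4 ℕ.* (n ℕ.* n)                                  ∎))
        where
        lem : ∀ m d → 4 ℕ.* (16 ℕ.* (m ℕ.* d) ℕ.* (16 ℕ.* (m ℕ.* d))) ≡ (m ℕ.* m) ℕ.* (1024 ℕ.* (d ℕ.* d))
        lem = ℕ-Solver.solve-∀

      16m+2≤n : 16 ℕ.* m ℕ.+ 2 ℕ.≤ n
      16m+2≤n with r ℕ.≤? 16
      -- Here m ≤ 17 and 16 · 17 + 2 = 274. Otherwise r ≥ 17, so r² ≥ 17r ≥ 16r + 17.
      ... | yes r≤16 = ℕₚ.≤-trans (ℕₚ.+-monoˡ-≤ 2 (ℕₚ.*-monoʳ-≤ 16 (ℕ.s≤s r≤16))) (ℕₚ.≤-trans (ℕₚ.m≤m+n 274 126) 400≤n)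
      ... | no  r≰16 = begin
        16 ℕ.* m ℕ.+ 2              ≡⟨ lem r ⟩
        suc (16 ℕ.* r ℕ.+ 17)       ≤⟨ ℕ.s≤s (ℕₚ.+-monoʳ-≤ (16 ℕ.* r) (ℕₚ.≰⇒> r≰16)) ⟩
        suc (16 ℕ.* r ℕ.+ r)        ≡⟨ cong suc (lem′ r) ⟩
        suc (17 ℕ.* r)              ≤⟨ ℕ.s≤s (ℕₚ.*-monoˡ-≤ r (ℕₚ.≰⇒> r≰16)) ⟩
        suc (r ℕ.* r)               ≤⟨ r²<n ⟩
        n                           ∎
        where
        lem : ∀ r → 16 ℕ.* suc r ℕ.+ 2 ≡ suc (16 ℕ.* r ℕ.+ 17)
        lem = ℕ-Solver.solve-∀
        lem′ : ∀ r → 16 ℕ.* r ℕ.+ r ≡ 17 ℕ.* r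
        lem′ = ℕ-Solver.solve-∀

      -- Twice the successor of the left side is 16md + (16m + 2), and each of the two summands is
      -- at most n.
      room : (4 ℕ.* m) ℕ.* (suc d ℕ.+ suc d) ℕ.≤ n′
      room = ℕ.s≤s⁻¹ (ℕₚ.*-cancelˡ-≤ 2 (begin
        2 ℕ.* suc ((4 ℕ.* m) ℕ.* (suc d ℕ.+ suc d))   ≡⟨ lem m d ⟩
        16 ℕ.* (m ℕ.* d) ℕ.+ (16 ℕ.* m ℕ.+ 2)         ≤⟨ ℕₚ.+-mono-≤ 16md≤n 16m+2≤n ⟩
        n ℕ.+ n                                       ≡⟨ cong (n ℕ.+_) (ℕₚ.+-identityʳ n) ⟨
        2 ℕ.* n                                       ∎))
        where
        lem : ∀ m d → 2 ℕ.* suc ((4 ℕ.* m) ℕ.* (suc d ℕ.+ suc d)) ≡ 16 ℕ.* (m ℕ.* d) ℕ.+ (16 ℕ.* m ℕ.+ 2)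
        lem = ℕ-Solver.solve-∀

      e≤n : suc d ℕ.≤ n
      e≤n = begin
        suc d                                ≤⟨ ℕₚ.m≤m+n (suc d) (suc d) ⟩
        suc d ℕ.+ suc d                      ≤⟨ ℕₚ.m≤n*m (suc d ℕ.+ suc d) (4 ℕ.* m) ⟩
        (4 ℕ.* m) ℕ.* (suc d ℕ.+ suc d)      ≤⟨ room ⟩
        n′                                   ≤⟨ ℕₚ.n≤1+n n′ ⟩
        n                                    ∎

  -- The two bounds for large n.

  upper : ∀ n → 400 ℕ.≤ n → Σ (Poly _) λ p → SignRep (FG n) p × (degree p ℕ.* degree p ℕ.≤ 9 ℕ.* n)
  upper n@(suc n′) 400≤n with ceilSqrt n | ceilSqrt-spec n (ℕ.s≤s ℕ.z≤n)
  ... | m | r , refl , lo , hi =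
    UpperBound.rep n m , UpperBound.sign-rep n m ,
    ℕₚ.≤-trans (ℕₚ.*-mono-≤ le le) (Arithmetic.[m+1]²≤9n n′ 0 r 400≤n lo hi)
    where le = UpperBound.degree-rep n m

  lower : ∀ n → 400 ℕ.≤ n → ∀ p → SignRep (FG n) p → n ℕ.≤ 1024 ℕ.* (degree p ℕ.* degree p)
  lower n@(suc n′) 400≤n with ceilSqrt n | ceilSqrt-spec n (ℕ.s≤s ℕ.z≤n)
  -- The polynomial is bound only after the match, since its type mentions `ceilSqrt n`, which the
  -- match replaces by `suc r`.
  ... | m | r , refl , lo , hi = λ p rep → ℕₚ.≮⇒≥ (λ small →
    Lower.absurd n′ m p rep (ℕₚ.≤-trans (ℕₚ.m≤m+n 2 398) 400≤n)
      (Arithmetic.e≤n n′ (degree p) r 400≤n lo hi small)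
      (Arithmetic.2e≤m n′ (degree p) r 400≤n lo hi small)
      (Arithmetic.room n′ (degree p) r 400≤n lo hi small))

open import Data.Nat using (ℕ; _≤_; _*_; _≥_; s≤s; z≤n)
open import Data.Product using (Σ; _×_; ∃; _,_)

theorem1p9 : Σ ℕ λ a → Σ ℕ λ b → Σ ℕ λ n₀ → (a ≥ 1) × (b ≥ 1) ×
    ((n : ℕ) → n ≥ n₀ →
    (Σ (Poly _) λ p → SignRep (FG n) p × (degree p * degree p ≤ b * n))
    × ((p : Poly _) → SignRep (FG n) p → n ≤ a * (degree p * degree p)))
-- As 1024 = 32² and 9 = 3², the degree lies between √n / 32 and 3 √n for n ≥ 400.
theorem1p9 = 1024 , 9 , 400 , s≤s z≤n , s≤s z≤n ,
  λ n n≥400 → ThresholdDegree.upper n n≥400 , ThresholdDegree.lower n n≥400
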